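{- Let $k \ge 2$ be an integer and $n \ge k+1$. Then the maximum size of a family $\mathcal{F} \subseteq 2^{[n]}$ that contains neither $Y_k$ nor $Y'_k$ as an induced subposet equals $\Sigma(n,k)$; that is, $\mathrm{La}^{\sharp}(n, \{Y_k, Y'_k\}) = \Sigma(n,k)$.
   Context: $[n]=\{1,\dots,n\}$ and $2^{[n]}$ is ordered by inclusion. For an integer $k\ge 2$, the poset $Y_k$ (also written $Y_{k,2}$) consists of $k+2$ distinct elements $x_1,\dots,x_k,y_1,y_2$ with $x_1 < x_2 < \dots < x_k$ and $x_k < y_1$, $x_k < y_2$ (and the relations implied by transitivity; $y_1,y_2$ incomparable). $Y'_k$ is the dual (reversed) poset of $Y_k$. A poset $P$ is contained in a family $\mathcal{F}$ as an induced subposet if there is an injection $\alpha: P \to \mathcal{F}$ with $x_1 <_P x_2 \iff \alpha(x_1) \subsetneq \alpha(x_2)$ for all $x_1,x_2 \in P$. $\mathrm{La}^{\sharp}(n,\{P,Q\})$ is the maximum size of a family $\mathcal{F}\subseteq 2^{[n]}$ containing neither $P$ nor $Q$ as an induced subposet. $\Sigma(n,k)$ denotes the sum of the $k$ largest binomial coefficients $\binom{n}{i}$, $0\le i\le n$. -}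

module Defs where

open import Data.Nat using (ℕ; zero; suc; _+_; _<_; _≤?_)
open import Data.Nat.Combinatorics using (_C_)
open import Data.Fin using (Fin; toℕ)
open import Data.Fin.Subset using (Subset; _⊂_)
open import Data.List using (List; []; _∷_; length; map; take; upTo)
open import Data.Nat.ListAction using (sum)
open import Data.List.Membership.Propositional using (_∈_)
open import Data.List.Relation.Unary.Unique.Propositional using (Unique)
open import Data.Product using (Σ; _×_; ∃)
open import Function using (_⇔_)
open import Function.Definitions using (Injective)
open import Relation.Binary.PropositionalEquality using (_≡_)
open import Relation.Nullary using (¬_; yes; no)

record Family (n : ℕ) : Set where
  constructor family
  field
    sets   : List (Subset n)
    unique : Unique sets
open Family public

size : ∀ {n} → Family n → ℕ
size F = length (sets F)

-- A finite poset on Fin m, given by its strict order relation.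
-- Y_k lives on Fin (k + 2): indices 0,...,k-1 are x_1 < ... < x_k,
-- indices k and k+1 are y_1, y_2.
-- i <_{Y_k} j  iff  toℕ i < toℕ j and i is one of the x's.
Yk : (k : ℕ) → Fin (k + 2) → Fin (k + 2) → Set
Yk k i j = toℕ i < toℕ j × toℕ i < k

Yk' : (k : ℕ) → Fin (k + 2) → Fin (k + 2) → Set
Yk' k i j = Yk k j i

ContainsInduced : ∀ {m n} → (Fin m → Fin m → Set) → Family n → Set
ContainsInduced {m} {n} _<P_ F =
  Σ (Fin m → Subset n) λ α →
    Injective _≡_ _≡_ α ×
    (∀ i → α i ∈ sets F) ×
    (∀ i j → (i <P j) ⇔ (α i ⊂ α j))

insertDesc : ℕ → List ℕ → List ℕ
insertDesc x [] = x ∷ []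
insertDesc x (y ∷ ys) with y ≤? x
... | yes _ = x ∷ y ∷ ys
... | no _  = y ∷ insertDesc x ys

sortDesc : List ℕ → List ℕ
sortDesc [] = []
sortDesc (x ∷ xs) = insertDesc x (sortDesc xs)

Sigma : ℕ → ℕ → ℕ
Sigma n k = sum (take k (sortDesc (map (n C_) (upTo (suc n)))))

{-# OPTIONS --safe #-}
module Submission where

-- Upper bound, for a family F without ∅ and [n].  Let U be the set of A ∈ F such that the members of F above A form
-- a chain, let D be its dual, M = U ∩ D and R = F ∖ (U ∪ D).  If A ∈ U is not maximal, pick u ∉ A lying in all members
-- of F above A and v lying in none of them: transposing u and v shows that at most half of the maximal chains through A
-- meet F above A.  Since all members of U on a maximal chain, except the top one, have a member of U above them on the
-- chain, the average of 2|U ∩ C| over the maximal chains C is at most that of |U° ∩ C| + 2[U ∩ C ≠ ∅], where U° is the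
-- set of non-maximal members of U; dually for D.  As |F ∩ C| + |M ∩ C| = |U ∩ C| + |D ∩ C| + |R ∩ C|, and a chain of
-- members of F outside U (outside D) has fewer than s (than r) elements if F has no Y_s and no Y'_r, comparing on each
-- C gives the LYM inequality 2 Σ_{A ∈ F} 1/C(n,|A|) ≤ s + r for s, r ≥ 2; this implies |F| ≤ Σ(n,k) for s = r = k.
--
-- The LYM inequality fails in the presence of ∅ or [n].  Removing ∅ leaves a Y_{k-1}-free family, and removing [n]
-- a Y'_{k-1}-free one, which improves the bound by enough to make up for the removed sets.  For k = 2 this leads to
-- s = 1 or r = 1, where U = F or D = F and LYM holds for F together with a second copy of its maximal (minimal) members.

open import Defs
open import Data.Nat
open import Data.Nat.Properties
open import Algebra.Properties.CommutativeMonoid.Sum +-0-commutativeMonoid using (sum-cong-≗; ∑-distrib-+; sum-permute) renaming (sum to ∑ᶠ)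
open import Algebra.Properties.CommutativeSemigroup +-commutativeSemigroup using (interchange; x∙yz≈y∙xz)
open import Data.Bool using (true; false; if_then_else_)
open import Data.Bool.Properties using () renaming (_≟_ to _≟ᵇ_)
open import Data.Fin using (Fin; zero; suc; toℕ; fromℕ<) renaming (_≟_ to _≟ᶠ_)
open import Data.Fin.Permutation as Perm using (Permutation′; _⟨$⟩ˡ_; _⟨$⟩ʳ_; inverseˡ; inverseʳ)
open import Data.Fin.Properties using (¬∀⟶∃¬; toℕ<n; toℕ-injective; toℕ-fromℕ<; pigeonhole)
open import Data.Fin.Subset using (Subset; inside; outside; ∣_∣; _⊂_; ⊥; ⊤) renaming (_∈_ to _∈ˢ_; _∉_ to _∉ˢ_; _⊆_ to _⊆ˢ_)
open import Data.Fin.Subset.Properties using (⊆-refl; ⊆-trans; ⊆-antisym; ⊂-trans; ⊂-⊆-trans; ⊂-irref; p⊂q⇒p⊆q; p⊂q⇒∣p∣<∣q∣; ∣p∣≤n; ∣⊥∣≡0; ⊥⊆; ⊆⊤; ∉⊥; ∈⊤; drop-∷-⊆; nonempty?; Empty-unique; _⊆?_; _⊂?_) renaming (_∈?_ to _∈ˢ?_)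
open import Data.List as List using (List; []; _∷_; map; length; filter; take; reverse; upTo; applyUpTo; concatMap; _++_)
open import Data.List.Properties using (length-map; length-upTo; length-applyUpTo; length-++; length-take; map-∘; take-map; unfold-reverse)
open import Data.List.Membership.Propositional using (_∈_; _∉_; find; lose)
open import Data.List.Membership.Propositional.Properties using (∈-∃++; ∈-++⁻; ∈-++⁺ˡ; ∈-++⁺ʳ; ∈-map⁻; ∈-filter⁻; ∈-filter⁺; ∈-upTo⁺; ∈-upTo⁻; ∈-applyUpTo⁻)
open import Data.List.Relation.Unary.Any as Any using (Any; here; there; any?; index)
open import Data.List.Relation.Unary.Any.Properties using (lookup-index)
open import Data.List.Relation.Unary.All as All using (All; []; _∷_; all?)
open import Data.List.Relation.Unary.All.Properties as Allₚ using (¬All⇒Any¬; all-filter)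
open import Data.List.Relation.Unary.AllPairs as AllPairs using (AllPairs; []; _∷_)
open import Data.List.Relation.Unary.Unique.Propositional using (Unique)
open import Data.List.Relation.Unary.Unique.Propositional.Properties as Uniqueₚ using (Unique[x∷xs]⇒x∉xs; upTo⁺; applyUpTo⁺₁)
open import Data.List.Relation.Binary.Disjoint.Propositional using (Disjoint)
open import Data.List.Relation.Binary.Permutation.Propositional using (_↭_; ↭-refl; ↭-sym; ↭-trans; prep; swap; ↭⇒↭ₛ)
open import Data.List.Relation.Binary.Permutation.Propositional.Properties using (map⁺; shift; ∈-resp-↭; Any-resp-↭; All-resp-↭; ↭-reverse; ↭-length)
open import Data.List.Relation.Binary.Permutation.Setoid.Properties using (Unique-resp-↭)
open import Data.Nat.Combinatorics using (nC1≡n; k![n∸k]!∣n!; nCk+nC[k+1]≡[n+1]C[k+1]) renaming (_C_ to infixl 8 _choose_)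
open import Data.Nat.Combinatorics.Specification using (nCk≡n!/k![n-k]!)
open import Data.Nat.DivMod using (m/n*n≡m)
open import Data.Nat.ListAction using (sum)
open import Data.Nat.ListAction.Properties using (sum-↭)
open import Data.Nat.Solver using (module +-*-Solver)
open import Data.Product using (Σ; ∃; ∃₂; _×_; _,_; proj₁; proj₂)
open import Data.Sum using (_⊎_; inj₁; inj₂; [_,_]′) renaming (swap to ⊎-swap)
open import Data.Unit using (tt) renaming (⊤ to Unit)
open import Data.Vec using ([]; _∷_; here; there; lookup; tabulate; _[_]≔_)
open import Data.Vec.Properties using (lookup∘tabulate; lookup∘update; lookup∘update′; []=⇒lookup; lookup⇒[]=; tabulate-cong; tabulate∘lookup; ∷-injectiveˡ; ∷-injectiveʳ; ≡-dec)
open import Function using (_∘_; id; flip; _⇔_; mk⇔; Equivalence)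
open import Relation.Binary.Definitions using (DecidableEquality; Transitive) renaming (Decidable to Decidable₂)
open import Relation.Nullary using (Dec; yes; no; does; ¬_; ¬?; contradiction)
open import Relation.Nullary.Decidable using (_×-dec_; _⊎-dec_; _→-dec_; decidable-stable)
open import Relation.Unary using (Decidable)
open import Relation.Binary.PropositionalEquality
import Data.List.Membership.DecPropositional as DecMembership
import Data.List.Relation.Unary.AllPairs.Properties as APₚ

-- Indicators and sums over lists

⟦_⟧ : {P : Set} → Dec P → ℕ
⟦ d ⟧ = if does d then 1 else 0

⟦⟧-yes : {P : Set} (d : Dec P) → P → ⟦ d ⟧ ≡ 1
⟦⟧-yes (yes _) _ = refl
⟦⟧-yes (no ¬p) p = contradiction p ¬p

⟦⟧-no : {P : Set} (d : Dec P) → ¬ P → ⟦ d ⟧ ≡ 0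
⟦⟧-no (yes p) ¬p = contradiction p ¬p
⟦⟧-no (no _) _ = refl

⟦⟧≤1 : {P : Set} (d : Dec P) → ⟦ d ⟧ ≤ 1
⟦⟧≤1 (yes _) = ≤-refl
⟦⟧≤1 (no _) = z≤n

⟦⟧-mono : {P Q : Set} (d : Dec P) (e : Dec Q) → (P → Q) → ⟦ d ⟧ ≤ ⟦ e ⟧
⟦⟧-mono (yes p) e f = ≤-reflexive (sym (⟦⟧-yes e (f p)))
⟦⟧-mono (no _) e f = z≤n

⟦⟧-cong : {P Q : Set} (d : Dec P) (e : Dec Q) → (P → Q) → (Q → P) → ⟦ d ⟧ ≡ ⟦ e ⟧
⟦⟧-cong d e f g = ≤-antisym (⟦⟧-mono d e f) (⟦⟧-mono e d g)

∑ : {A : Set} → List A → (A → ℕ) → ℕ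
∑ xs f = sum (map f xs)

module _ {A : Set} where

  ∑-mono : ∀ (xs : List A) {f g} → (∀ {x} → x ∈ xs → f x ≤ g x) → ∑ xs f ≤ ∑ xs g
  ∑-mono [] _ = z≤n
  ∑-mono (x ∷ xs) le = +-mono-≤ (le (here refl)) (∑-mono xs (le ∘ there))

  ∑-cong : ∀ (xs : List A) {f g} → (∀ {x} → x ∈ xs → f x ≡ g x) → ∑ xs f ≡ ∑ xs g
  ∑-cong xs eq = ≤-antisym (∑-mono xs (≤-reflexive ∘ eq)) (∑-mono xs (≤-reflexive ∘ sym ∘ eq))

  ∑-+ : ∀ (xs : List A) f g → ∑ xs (λ x → f x + g x) ≡ ∑ xs f + ∑ xs g
  ∑-+ [] f g = refl
  ∑-+ (x ∷ xs) f g = trans (cong (f x + g x +_) (∑-+ xs f g)) (interchange (f x) _ _ _)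

  ∑-*ˡ : ∀ (xs : List A) c f → ∑ xs (λ x → c * f x) ≡ c * ∑ xs f
  ∑-*ˡ [] c f = sym (*-zeroʳ c)
  ∑-*ˡ (x ∷ xs) c f = trans (cong (c * f x +_) (∑-*ˡ xs c f)) (sym (*-distribˡ-+ c (f x) _))

  ∑-const : ∀ (xs : List A) c → ∑ xs (λ _ → c) ≡ length xs * c
  ∑-const [] c = refl
  ∑-const (x ∷ xs) c = cong (c +_) (∑-const xs c)

  ∑-zero : ∀ (xs : List A) {f} → (∀ {x} → x ∈ xs → f x ≡ 0) → ∑ xs f ≡ 0
  ∑-zero xs eq = trans (∑-cong xs eq) (trans (∑-const xs 0) (*-zeroʳ (length xs)))

∑-swap : ∀ {A B : Set} (xs : List A) (ys : List B) (f : A → B → ℕ) →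
         ∑ xs (λ x → ∑ ys (f x)) ≡ ∑ ys (λ y → ∑ xs (λ x → f x y))
∑-swap [] ys f = sym (∑-zero ys λ _ → refl)
∑-swap (x ∷ xs) ys f = trans (cong (∑ ys (f x) +_) (∑-swap xs ys f)) (sym (∑-+ ys (f x) _))

module _ {A : Set} where

  ∑-↭ : ∀ {xs ys : List A} f → xs ↭ ys → ∑ xs f ≡ ∑ ys f
  ∑-↭ f p = sum-↭ (map⁺ f p)

  member≤∑ : ∀ {xs : List A} f {x} → x ∈ xs → f x ≤ ∑ xs f
  member≤∑ f (here refl) = m≤m+n _ _
  member≤∑ f (there x∈) = m≤n⇒m≤o+n _ (member≤∑ f x∈)

  -- Each entry of `xs` is cancelled against one occurrence in `ys`; uniqueness of `xs` keeps the
  -- remaining entries away from the cancelled occurrence.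
  ∑-⊆ : ∀ {xs ys : List A} f → Unique xs → (∀ {x} → x ∈ xs → x ∈ ys) → ∑ xs f ≤ ∑ ys f
  ∑-⊆ {[]} f _ _ = z≤n
  ∑-⊆ {x ∷ xs} f uq@(_ ∷ uq′) sub with ∈-∃++ (sub (here refl))
  ... | as , bs , refl = begin
      f x + ∑ xs f          ≤⟨ +-monoʳ-≤ (f x) (∑-⊆ f uq′ sub′) ⟩
      f x + ∑ (as ++ bs) f  ≡⟨ ∑-↭ f (↭-sym (shift x as bs)) ⟩
      ∑ (as ++ x ∷ bs) f    ∎
    where
    open ≤-Reasoning
    sub′ : ∀ {y} → y ∈ xs → y ∈ as ++ bs
    sub′ {y} y∈ with ∈-++⁻ as (sub (there y∈))
    ... | inj₁ y∈as = ∈-++⁺ˡ y∈as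
    ... | inj₂ (here refl) = contradiction y∈ (Unique[x∷xs]⇒x∉xs uq)
    ... | inj₂ (there y∈bs) = ∈-++⁺ʳ as y∈bs

  module _ (_≟ᴬ_ : DecidableEquality A) where
    open DecMembership _≟ᴬ_ using (_∈?_)

    ∑-δ : ∀ {xs} (f : A → ℕ) y → Unique xs → ∑ xs (λ x → ⟦ x ≟ᴬ y ⟧ * f x) ≡ ⟦ y ∈? xs ⟧ * f y
    ∑-δ {[]} f y uq = refl
    ∑-δ {x ∷ xs} f y uq@(_ ∷ uq′) with x ≟ᴬ y
    ... | yes refl = trans (cong₂ _+_ (*-identityˡ (f x)) (∑-δ f y uq′))
            (trans (cong (λ z → f x + z * f x) (⟦⟧-no (x ∈? xs) (Unique[x∷xs]⇒x∉xs uq)))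
              (sym (cong (_* f x) (⟦⟧-yes (x ∈? (x ∷ xs)) (here refl)))))
    ... | no x≢y = trans (∑-δ f y uq′) (cong (_* f y)
            (⟦⟧-cong (y ∈? xs) (y ∈? (x ∷ xs)) there
              λ { (here refl) → contradiction refl x≢y ; (there y∈) → y∈ }))

    -- Both sides sum `f` over the common entries: the indicator becomes a sum of deltas and the two
    -- sums are exchanged. This passes between the chain members in a family and the family members
    -- on a chain.
    ∑-∈-swap : ∀ {xs ys} (f : A → ℕ) → Unique xs → Unique ys →
               ∑ xs (λ x → ⟦ x ∈? ys ⟧ * f x) ≡ ∑ ys (λ y → ⟦ y ∈? xs ⟧ * f y)
    ∑-∈-swap {xs} {ys} f uxs uys = begin
      ∑ xs (λ x → ⟦ x ∈? ys ⟧ * f x)                    ≡⟨ ∑-cong xs (λ {x} _ → sym (∑-δ (λ _ → f x) x uys)) ⟩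
      ∑ xs (λ x → ∑ ys (λ y → ⟦ y ≟ᴬ x ⟧ * f x))        ≡⟨ ∑-swap xs ys _ ⟩
      ∑ ys (λ y → ∑ xs (λ x → ⟦ y ≟ᴬ x ⟧ * f x))        ≡⟨ ∑-cong ys (λ {y} _ → ∑-cong xs λ {x} _ →
                                                             cong (_* f x) (⟦⟧-cong (y ≟ᴬ x) (x ≟ᴬ y) sym sym)) ⟩
      ∑ ys (λ y → ∑ xs (λ x → ⟦ x ≟ᴬ y ⟧ * f x))        ≡⟨ ∑-cong ys (λ {y} _ → ∑-δ f y uxs) ⟩
      ∑ ys (λ y → ⟦ y ∈? xs ⟧ * f y)                    ∎
      where open ≡-Reasoning

-- Summation over maximal chains

_≟ˢ_ : ∀ {n} → DecidableEquality (Subset n)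
_≟ˢ_ = ≡-dec _≟ᵇ_

lookup-ext : ∀ {n} {A B : Subset n} → (∀ i → lookup A i ≡ lookup B i) → A ≡ B
lookup-ext {A = A} {B} eq =
  trans (sym (tabulate∘lookup A)) (trans (tabulate-cong eq) (tabulate∘lookup B))

lookup-false : ∀ {n} {A : Subset n} {i} → lookup A i ≡ false → i ∉ˢ A
lookup-false eq i∈A with trans (sym eq) ([]=⇒lookup i∈A)
... | ()

∉⇒lookup-false : ∀ {n} {A : Subset n} {i} → i ∉ˢ A → lookup A i ≡ false
∉⇒lookup-false {A = A} {i} i∉A with lookup A i in eq
... | true = contradiction (lookup⇒[]= i A eq) i∉A
... | false = refl

⊆∧∣≡∣⇒≡ : ∀ {n} {A B : Subset n} → A ⊆ˢ B → ∣ A ∣ ≡ ∣ B ∣ → A ≡ B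
⊆∧∣≡∣⇒≡ {A = A} A⊆B eq = ⊆-antisym A⊆B λ {x} x∈B → decidable-stable (x ∈ˢ? A)
  λ x∉A → <⇒≢ (p⊂q⇒∣p∣<∣q∣ (A⊆B , x , x∈B , x∉A)) eq

infixl 6 _⊕_
_⊕_ : ∀ {n} → Subset n → Fin n → Subset n
A ⊕ i = A [ i ]≔ inside

lookup-⊕-other : ∀ {n} (A : Subset n) {i j} → j ≢ i → lookup (A ⊕ i) j ≡ lookup A j
lookup-⊕-other A {i} {j} j≢i = lookup∘update′ j≢i A inside

i∈A⊕i : ∀ {n} (A : Subset n) i → i ∈ˢ A ⊕ i
i∈A⊕i A i = lookup⇒[]= i (A ⊕ i) (lookup∘update i A inside)

A⊆A⊕i : ∀ {n} (A : Subset n) i → A ⊆ˢ A ⊕ i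
A⊆A⊕i A i {j} j∈A with j ≟ᶠ i
... | yes refl = i∈A⊕i A i
... | no j≢i = lookup⇒[]= j (A ⊕ i) (trans (lookup-⊕-other A j≢i) ([]=⇒lookup j∈A))

⊕-⊆ : ∀ {n} {A B : Subset n} {i} → A ⊆ˢ B → i ∈ˢ B → A ⊕ i ⊆ˢ B
⊕-⊆ {A = A} {i = i} A⊆B i∈B {j} j∈ with j ≟ᶠ i
... | yes refl = i∈B
... | no j≢i = A⊆B (lookup⇒[]= j A (trans (sym (lookup-⊕-other A j≢i)) ([]=⇒lookup j∈)))

A⊂A⊕i : ∀ {n} {A : Subset n} {i} → i ∉ˢ A → A ⊂ A ⊕ i
A⊂A⊕i {A = A} {i} i∉A = A⊆A⊕i A i , i , i∈A⊕i A i , i∉A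

∣A⊕i∣ : ∀ {n} (A : Subset n) {i} → lookup A i ≡ false → ∣ A ⊕ i ∣ ≡ suc ∣ A ∣
∣A⊕i∣ (.false ∷ A) {zero} refl = refl
∣A⊕i∣ (true ∷ A) {suc i} eq = cong suc (∣A⊕i∣ A eq)
∣A⊕i∣ (false ∷ A) {suc i} eq = ∣A⊕i∣ A eq

∑ᶠ-mono : ∀ {n} {f g : Fin n → ℕ} → (∀ i → f i ≤ g i) → ∑ᶠ f ≤ ∑ᶠ g
∑ᶠ-mono {zero} le = z≤n
∑ᶠ-mono {suc n} le = +-mono-≤ (le zero) (∑ᶠ-mono (le ∘ suc))

∑ᶠ-*ˡ : ∀ {n} c (f : Fin n → ℕ) → ∑ᶠ (λ i → c * f i) ≡ c * ∑ᶠ f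
∑ᶠ-*ˡ {zero} c f = sym (*-zeroʳ c)
∑ᶠ-*ˡ {suc n} c f = trans (cong (c * f zero +_) (∑ᶠ-*ˡ c (f ∘ suc))) (sym (*-distribˡ-+ c (f zero) _))

-- Additive form of `(n - ∣ A ∣) * c`, which avoids truncated subtraction.
∑ᶠ-∉ : ∀ {n} (A : Subset n) c → ∑ᶠ (λ i → if lookup A i then 0 else c) + ∣ A ∣ * c ≡ n * c
∑ᶠ-∉ [] c = refl
∑ᶠ-∉ (true ∷ A) c = trans (x∙yz≈y∙xz (∑ᶠ λ i → if lookup A i then 0 else c) c (∣ A ∣ * c)) (cong (c +_) (∑ᶠ-∉ A c))
∑ᶠ-∉ (false ∷ A) c = trans (+-assoc c _ _) (cong (c +_) (∑ᶠ-∉ A c))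

∑ᶠ-between : ∀ {n} (A B : Subset n) c → A ⊆ˢ B →
  ∑ᶠ (λ i → if lookup A i then 0 else (if lookup B i then c else 0)) + ∣ A ∣ * c ≡ ∣ B ∣ * c
∑ᶠ-between [] [] c _ = refl
∑ᶠ-between (true ∷ A) (false ∷ B) c A⊆B with A⊆B here
... | ()
∑ᶠ-between (true ∷ A) (true ∷ B) c A⊆B =
  trans (x∙yz≈y∙xz (∑ᶠ λ i → if lookup A i then 0 else (if lookup B i then c else 0)) c (∣ A ∣ * c))
    (cong (c +_) (∑ᶠ-between A B c (drop-∷-⊆ A⊆B)))
∑ᶠ-between (false ∷ A) (true ∷ B) c A⊆B =
  trans (+-assoc c _ _) (cong (c +_) (∑ᶠ-between A B c (drop-∷-⊆ A⊆B)))
∑ᶠ-between (false ∷ A) (false ∷ B) c A⊆B = ∑ᶠ-between A B c (drop-∷-⊆ A⊆B)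

-- Saturated chains from a given set, and sums over them

module _ {n : ℕ} where

  open DecMembership (_≟ˢ_ {n}) using (_∈?_)

  -- Saturated chains of `j` steps starting at `A`, listed from the bottom up. For `A = ⊥` and
  -- `j = n` they are the maximal chains.
  data Path : ℕ → Subset n → List (Subset n) → Set where
    stop : ∀ {A} → Path 0 A (A ∷ [])
    step : ∀ {j A i C} → i ∉ˢ A → Path j (A ⊕ i) C → Path (suc j) A (A ∷ C)

  -- Recursion on the first step replaces a list of all paths: the prefix walked so far is absorbed
  -- into `g`, and an element already in `A`, which gives no step, contributes 0.
  ∑ᵖ : ℕ → Subset n → (List (Subset n) → ℕ) → ℕ
  ∑ᵖ zero A g = g (A ∷ [])
  ∑ᵖ (suc j) A g = ∑ᶠ λ i → if lookup A i then 0 else ∑ᵖ j (A ⊕ i) (g ∘ (A ∷_))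

  ∑ᵖ-mono : ∀ j A {g h} → (∀ {C} → Path j A C → g C ≤ h C) → ∑ᵖ j A g ≤ ∑ᵖ j A h
  ∑ᵖ-mono zero A le = le stop
  ∑ᵖ-mono (suc j) A {g} {h} le = ∑ᶠ-mono mono
    where
    mono : ∀ i → (if lookup A i then 0 else ∑ᵖ j (A ⊕ i) (g ∘ (A ∷_))) ≤
                 (if lookup A i then 0 else ∑ᵖ j (A ⊕ i) (h ∘ (A ∷_)))
    mono i with lookup A i in eq
    ... | true = z≤n
    ... | false = ∑ᵖ-mono j (A ⊕ i) (le ∘ step (lookup-false eq))

  ∑ᵖ-cong : ∀ j A {g h} → (∀ {C} → Path j A C → g C ≡ h C) → ∑ᵖ j A g ≡ ∑ᵖ j A h
  ∑ᵖ-cong j A eq = ≤-antisym (∑ᵖ-mono j A (≤-reflexive ∘ eq)) (∑ᵖ-mono j A (≤-reflexive ∘ sym ∘ eq))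

  ∑ᵖ-+ : ∀ j A g h → ∑ᵖ j A (λ C → g C + h C) ≡ ∑ᵖ j A g + ∑ᵖ j A h
  ∑ᵖ-+ zero A g h = refl
  ∑ᵖ-+ (suc j) A g h = trans (sum-cong-≗ split) (∑-distrib-+
    (λ i → if lookup A i then 0 else ∑ᵖ j (A ⊕ i) (g ∘ (A ∷_)))
    (λ i → if lookup A i then 0 else ∑ᵖ j (A ⊕ i) (h ∘ (A ∷_))))
    where
    split : ∀ i → (if lookup A i then 0 else ∑ᵖ j (A ⊕ i) (λ C → g (A ∷ C) + h (A ∷ C))) ≡
                  (if lookup A i then 0 else ∑ᵖ j (A ⊕ i) (g ∘ (A ∷_))) +
                  (if lookup A i then 0 else ∑ᵖ j (A ⊕ i) (h ∘ (A ∷_)))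
    split i with lookup A i
    ... | true = refl
    ... | false = ∑ᵖ-+ j (A ⊕ i) _ _

  ∑ᵖ-*ˡ : ∀ j A c g → ∑ᵖ j A (λ C → c * g C) ≡ c * ∑ᵖ j A g
  ∑ᵖ-*ˡ zero A c g = refl
  ∑ᵖ-*ˡ (suc j) A c g = trans (sum-cong-≗ pull) (∑ᶠ-*ˡ c λ i → if lookup A i then 0 else ∑ᵖ j (A ⊕ i) (g ∘ (A ∷_)))
    where
    pull : ∀ i → (if lookup A i then 0 else ∑ᵖ j (A ⊕ i) (λ C → c * g (A ∷ C))) ≡
                 c * (if lookup A i then 0 else ∑ᵖ j (A ⊕ i) (g ∘ (A ∷_)))
    pull i with lookup A i
    ... | true = sym (*-zeroʳ c)
    ... | false = ∑ᵖ-*ˡ j (A ⊕ i) c _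

  ∑ᵖ-∑ : ∀ {X : Set} j A (xs : List X) (f : X → List (Subset n) → ℕ) →
         ∑ᵖ j A (λ C → ∑ xs (λ x → f x C)) ≡ ∑ xs (λ x → ∑ᵖ j A (f x))
  ∑ᵖ-∑ j A [] f = ∑ᵖ-*ˡ j A 0 (λ _ → 0)
  ∑ᵖ-∑ j A (x ∷ xs) f = trans (∑ᵖ-+ j A (f x) _) (cong (∑ᵖ j A (f x) +_) (∑ᵖ-∑ j A xs f))

  -- There are `n - ∣ A ∣ = suc j` first steps and `j !` continuations of each.
  ∑ᵖ-const : ∀ j A c → ∣ A ∣ + j ≡ n → ∑ᵖ j A (λ _ → c) ≡ j ! * c
  ∑ᵖ-const zero A c _ = sym (*-identityˡ c)
  ∑ᵖ-const (suc j) A c eq = +-cancelʳ-≡ (∣ A ∣ * (j ! * c)) _ _ (begin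
      ∑ᵖ (suc j) A (λ _ → c) + ∣ A ∣ * (j ! * c)                      ≡⟨ cong (_+ ∣ A ∣ * (j ! * c)) (sum-cong-≗ inner) ⟩
      ∑ᶠ (λ i → if lookup A i then 0 else j ! * c) + ∣ A ∣ * (j ! * c) ≡⟨ ∑ᶠ-∉ A (j ! * c) ⟩
      n * (j ! * c)                                                  ≡⟨ cong (_* (j ! * c)) (trans (sym eq) (+-comm ∣ A ∣ (suc j))) ⟩
      (suc j + ∣ A ∣) * (j ! * c)                                     ≡⟨ *-distribʳ-+ (j ! * c) (suc j) ∣ A ∣ ⟩
      suc j * (j ! * c) + ∣ A ∣ * (j ! * c)                           ≡⟨ cong (_+ ∣ A ∣ * (j ! * c)) (sym (*-assoc (suc j) (j !) c)) ⟩
      suc j ! * c + ∣ A ∣ * (j ! * c)                                 ∎)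
    where
    open ≡-Reasoning
    inner : ∀ i → (if lookup A i then 0 else ∑ᵖ j (A ⊕ i) (λ _ → c)) ≡ (if lookup A i then 0 else j ! * c)
    inner i with lookup A i in e
    ... | true = refl
    ... | false = ∑ᵖ-const j (A ⊕ i) c (trans (cong (_+ j) (∣A⊕i∣ A e)) (trans (sym (+-suc ∣ A ∣ j)) eq))

  -- A path through `B` first adds the `d` elements of `B` outside `A`, in any of `d !` orders, and
  -- then the other `e` elements in any of `e !` orders. The induction keeps the first steps inside
  -- `B` and drops the others.
  ∑ᵖ-through : ∀ d e A B → A ⊆ˢ B → ∣ A ∣ + d ≡ ∣ B ∣ → ∣ B ∣ + e ≡ n →
               d ! * e ! ≤ ∑ᵖ (d + e) A (λ C → ⟦ B ∈? C ⟧)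
  ∑ᵖ-through zero e A B A⊆B eqd eqe = begin
      1 * e !                          ≡⟨ *-comm 1 (e !) ⟩
      e ! * 1                          ≡⟨ sym (∑ᵖ-const e A 1 (trans (cong (_+ e) (trans (sym (+-identityʳ ∣ A ∣)) eqd)) eqe)) ⟩
      ∑ᵖ e A (λ _ → 1)                 ≤⟨ ∑ᵖ-mono e A (λ p → ≤-reflexive (sym (⟦⟧-yes (B ∈? _) (head∈ p)))) ⟩
      ∑ᵖ e A (λ C → ⟦ B ∈? C ⟧)        ∎
    where
    open ≤-Reasoning
    B≡A : B ≡ A
    B≡A = sym (⊆∧∣≡∣⇒≡ A⊆B (trans (sym (+-identityʳ ∣ A ∣)) eqd))
    head∈ : ∀ {C} → Path e A C → B ∈ C
    head∈ stop = here B≡A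
    head∈ (step _ _) = here B≡A
  ∑ᵖ-through (suc d) e A B A⊆B eqd eqe = +-cancelʳ-≤ (∣ A ∣ * c) _ _ (begin
      suc d * d ! * e ! + ∣ A ∣ * c ≡⟨ cong (_+ ∣ A ∣ * c) (*-assoc (suc d) (d !) (e !)) ⟩
      suc d * c + ∣ A ∣ * c         ≡⟨ sym (*-distribʳ-+ c (suc d) ∣ A ∣) ⟩
      (suc d + ∣ A ∣) * c           ≡⟨ cong (_* c) (trans (+-comm (suc d) ∣ A ∣) eqd) ⟩
      ∣ B ∣ * c                     ≡⟨ sym (∑ᶠ-between A B c A⊆B) ⟩
      ∑ᶠ (λ i → if lookup A i then 0 else (if lookup B i then c else 0)) + ∣ A ∣ * c
                                   ≤⟨ +-monoˡ-≤ (∣ A ∣ * c) (∑ᶠ-mono inner) ⟩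
      ∑ᵖ (suc (d + e)) A (λ C → ⟦ B ∈? C ⟧) + ∣ A ∣ * c ∎)
    where
    open ≤-Reasoning
    c = d ! * e !
    inner : ∀ i → (if lookup A i then 0 else (if lookup B i then c else 0)) ≤
                  (if lookup A i then 0 else ∑ᵖ (d + e) (A ⊕ i) (λ C → ⟦ B ∈? (A ∷ C) ⟧))
    inner i with lookup A i in ea
    ... | true = z≤n
    ... | false with lookup B i in eb
    ...   | false = z≤n
    ...   | true = ≤-trans
              (∑ᵖ-through d e (A ⊕ i) B (⊕-⊆ A⊆B (lookup⇒[]= i B eb))
                (trans (cong (_+ d) (∣A⊕i∣ A ea)) (trans (sym (+-suc ∣ A ∣ d)) eqd)) eqe)
              (∑ᵖ-mono (d + e) (A ⊕ i) λ {C} _ → ⟦⟧-mono (B ∈? C) (B ∈? (A ∷ C)) there)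

  path-⊇ : ∀ {j A C} → Path j A C → All (A ⊆ˢ_) C
  path-⊇ stop = ⊆-refl ∷ []
  path-⊇ {A = A} (step {i = i} i∉A p) = ⊆-refl ∷ All.map (⊆-trans (A⊆A⊕i A i)) (path-⊇ p)

  path-sorted : ∀ {j A C} → Path j A C → AllPairs _⊂_ C
  path-sorted stop = [] ∷ []
  path-sorted (step i∉A p) = All.map (⊂-⊆-trans (A⊂A⊕i i∉A)) (path-⊇ p) ∷ path-sorted p

  -- The function `f` is general because `applyUpTo` recurses by passing to `f ∘ suc`, in accordance
  -- with the size going up by one at each step.
  path-sizes : ∀ {j A C} f → (∀ m → f m ≡ ∣ A ∣ + m) → Path j A C → map ∣_∣ C ≡ applyUpTo f (suc j)
  path-sizes f eq stop = cong (_∷ []) (sym (trans (eq 0) (+-identityʳ _)))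
  path-sizes {A = A} f eq (step i∉A p) =
    cong₂ _∷_ (sym (trans (eq 0) (+-identityʳ _)))
      (path-sizes (f ∘ suc) (λ m → trans (eq (suc m)) (trans (+-suc ∣ A ∣ m)
        (cong (_+ m) (sym (∣A⊕i∣ A (∉⇒lookup-false i∉A)))))) p)

  -- Permutations acting on sets and chains

  act : Permutation′ n → Subset n → Subset n
  act π A = tabulate λ i → lookup A (π ⟨$⟩ˡ i)

  lookup-act : ∀ π A i → lookup (act π A) i ≡ lookup A (π ⟨$⟩ˡ i)
  lookup-act π A = lookup∘tabulate _

  lookup-act-ʳ : ∀ π A i → lookup (act π A) (π ⟨$⟩ʳ i) ≡ lookup A i
  lookup-act-ʳ π A i = trans (lookup-act π A _) (cong (lookup A) (inverseˡ π))

  act-⊕ : ∀ π A i → act π (A ⊕ i) ≡ act π A ⊕ (π ⟨$⟩ʳ i)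
  act-⊕ π A i = lookup-ext λ j → trans (lookup-act π (A ⊕ i) j) (eq j)
    where
    eq : ∀ j → lookup (A ⊕ i) (π ⟨$⟩ˡ j) ≡ lookup (act π A ⊕ (π ⟨$⟩ʳ i)) j
    eq j with j ≟ᶠ π ⟨$⟩ʳ i
    ... | yes refl = trans (cong (lookup (A ⊕ i)) (inverseˡ π))
            (trans (lookup∘update i A inside) (sym (lookup∘update (π ⟨$⟩ʳ i) (act π A) inside)))
    ... | no j≢ = trans (lookup-⊕-other A λ e → j≢ (trans (sym (inverseʳ π)) (cong (π ⟨$⟩ʳ_) e)))
            (sym (trans (lookup-⊕-other (act π A) j≢) (lookup-act π A j)))

  -- A permutation carries the paths from `A` bijectively to those from `act π A`: the first step is
  -- reindexed by `π`, which is compatible with `⊕`, and induction does the rest.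
  ∑ᵖ-act : ∀ π j A g → ∑ᵖ j (act π A) g ≡ ∑ᵖ j A (g ∘ map (act π))
  ∑ᵖ-act π zero A g = refl
  ∑ᵖ-act π (suc j) A g = trans (sum-permute _ π) (sum-cong-≗ inner)
    where
    inner : ∀ i → (if lookup (act π A) (π ⟨$⟩ʳ i) then 0 else ∑ᵖ j (act π A ⊕ (π ⟨$⟩ʳ i)) (g ∘ (act π A ∷_))) ≡
                  (if lookup A i then 0 else ∑ᵖ j (A ⊕ i) (λ C → g (act π A ∷ map (act π) C)))
    inner i rewrite lookup-act-ʳ π A i | sym (act-⊕ π A i) with lookup A i
    ... | true = refl
    ... | false = ∑ᵖ-act π j (A ⊕ i) (g ∘ (act π A ∷_))

  act-⊥ : ∀ π → act π ⊥ ≡ ⊥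
  act-⊥ π = lookup-ext λ i → trans (lookup-act π ⊥ i) (trans (out (π ⟨$⟩ˡ i)) (sym (out i)))
    where
    out : ∀ i → lookup (⊥ {n}) i ≡ false
    out i = ∉⇒lookup-false {A = ⊥} {i} ∉⊥

Comparable : ∀ {n} → Subset n → Subset n → Set
Comparable A B = A ⊆ˢ B ⊎ B ⊆ˢ A

sorted⇒comparable : ∀ {n} {C : List (Subset n)} → AllPairs _⊂_ C → ∀ {A B} → A ∈ C → B ∈ C → Comparable A B
sorted⇒comparable (_ ∷ _) (here refl) (here refl) = inj₁ ⊆-refl
sorted⇒comparable (lt ∷ _) (here refl) (there B∈) = inj₁ (p⊂q⇒p⊆q (All.lookup lt B∈))
sorted⇒comparable (lt ∷ _) (there A∈) (here refl) = inj₂ (p⊂q⇒p⊆q (All.lookup lt A∈))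
sorted⇒comparable (_ ∷ ps) (there A∈) (there B∈) = sorted⇒comparable ps A∈ B∈

lookup-transposeˡ : ∀ {n} (u v : Fin n) (A : Subset n) → lookup (act (Perm.transpose u v) A) u ≡ lookup A v
lookup-transposeˡ u v A = trans (lookup-act (Perm.transpose u v) A u) (cong (lookup A) eq)
  where
  eq : Perm.transpose u v ⟨$⟩ˡ u ≡ v
  eq with u ≟ᶠ v
  ... | yes u≡v = u≡v
  ... | no _ with u ≟ᶠ u
  ...   | yes _ = refl
  ...   | no u≢u = contradiction refl u≢u

lookup-transposeʳ : ∀ {n} (u v : Fin n) (A : Subset n) → lookup (act (Perm.transpose u v) A) v ≡ lookup A u
lookup-transposeʳ u v A = trans (lookup-act (Perm.transpose u v) A v) (cong (lookup A) eq)
  where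
  eq : Perm.transpose u v ⟨$⟩ˡ v ≡ u
  eq with v ≟ᶠ v
  ... | yes _ = refl
  ... | no v≢v = contradiction refl v≢v

act-transpose-fixed : ∀ {n} (u v : Fin n) (A : Subset n) → lookup A u ≡ lookup A v → act (Perm.transpose u v) A ≡ A
act-transpose-fixed u v A e = lookup-ext λ i → trans (lookup-act (Perm.transpose u v) A i) (eq i)
  where
  eq : ∀ i → lookup A (Perm.transpose u v ⟨$⟩ˡ i) ≡ lookup A i
  eq i with i ≟ᶠ v
  ... | yes refl = e
  ... | no _ with i ≟ᶠ u
  ...   | yes refl = sym e
  ...   | no _ = refl

module _ {n : ℕ} where

  open DecMembership (_≟ˢ_ {n}) using (_∈?_)

  MaxChain : List (Subset n) → Set
  MaxChain = Path n ⊥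

  ∑ᶜ : (List (Subset n) → ℕ) → ℕ
  ∑ᶜ = ∑ᵖ n ⊥

  ∑ᶜ-const : ∀ c → ∑ᶜ (λ _ → c) ≡ n ! * c
  ∑ᶜ-const c = ∑ᵖ-const n ⊥ c (cong (_+ n) (∣⊥∣≡0 n))

  -- The number of maximal chains through A.
  weight : Subset n → ℕ
  weight A = ∣ A ∣ ! * (n ∸ ∣ A ∣) !

  weight≤∑ᶜ : ∀ A → weight A ≤ ∑ᶜ (λ C → ⟦ A ∈? C ⟧)
  weight≤∑ᶜ A = subst (λ m → weight A ≤ ∑ᵖ m ⊥ (λ C → ⟦ A ∈? C ⟧)) (m+[n∸m]≡n (∣p∣≤n A))
    (∑ᵖ-through ∣ A ∣ (n ∸ ∣ A ∣) ⊥ A ⊥⊆ (cong (_+ ∣ A ∣) (∣⊥∣≡0 n)) (m+[n∸m]≡n (∣p∣≤n A)))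

  maxChain-sizes : ∀ {C} → MaxChain C → map ∣_∣ C ≡ upTo (suc n)
  maxChain-sizes = path-sizes id λ m → cong (_+ m) (sym (∣⊥∣≡0 n))

  sorted⇒unique : ∀ {C : List (Subset n)} → AllPairs _⊂_ C → Unique C
  sorted⇒unique = AllPairs.map λ { (_ , _ , x∈ , x∉) refl → x∉ x∈ }

  -- Swapping u and v maps the chains through A that meet E injectively to chains through A that avoid E.
  half : ∀ {E : Subset n → Set} (E? : Decidable E) A u v → lookup A u ≡ lookup A v →
         (∀ {B} → E B → u ∈ˢ B × v ∉ˢ B) →
         2 * ∑ᶜ (λ C → ⟦ A ∈? C ⟧ * ⟦ any? E? C ⟧) ≤ ∑ᶜ (λ C → ⟦ A ∈? C ⟧)
  half {E} E? A u v A-fixed sep = begin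
      2 * ∑ᶜ g                            ≡⟨ cong (∑ᶜ g +_) (+-identityʳ _) ⟩
      -- The transposition `τ` fixes `⊥`, so it permutes the maximal chains and one of the two
      -- copies may be summed over the images.
      ∑ᶜ g + ∑ᶜ g                         ≡⟨ cong (λ Z → ∑ᶜ g + ∑ᵖ n Z g) (sym (act-⊥ τ)) ⟩
      ∑ᶜ g + ∑ᵖ n (act τ ⊥) g             ≡⟨ cong (∑ᶜ g +_) (∑ᵖ-act τ n ⊥ g) ⟩
      ∑ᶜ g + ∑ᶜ (g ∘ map (act τ))         ≡⟨ sym (∑ᵖ-+ n ⊥ g _) ⟩
      ∑ᶜ (λ C → g C + g (map (act τ) C))  ≤⟨ ∑ᵖ-mono n ⊥ pointwise ⟩
      ∑ᶜ (λ C → ⟦ A ∈? C ⟧)               ∎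
    where
    open ≤-Reasoning
    τ = Perm.transpose u v
    g : List (Subset n) → ℕ
    g C = ⟦ A ∈? C ⟧ * ⟦ any? E? C ⟧

    from-image : ∀ {C} → A ∈ map (act τ) C → A ∈ C
    from-image A∈ with ∈-map⁻ (act τ) A∈
    ... | X , X∈ , A≡τX = subst (_∈ _) (lookup-ext λ i →
            trans (sym (lookup-act-ʳ τ X i)) (trans (cong (λ Z → lookup Z (τ ⟨$⟩ʳ i)) (trans (sym A≡τX) (sym τA≡A)))
              (lookup-act-ʳ τ A i))) X∈
      where τA≡A = act-transpose-fixed u v A A-fixed

    -- A member of `E` on `C` contains `u` but not `v`, and the preimage of a member of `E` on the
    -- image chain contains `v` but not `u`. Both would lie on `C`, yet they are incomparable.
    avoid : ∀ {C} → MaxChain C → Any E C → ¬ Any E (map (act τ) C)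
    avoid p hit hit′ with find hit | find hit′
    ... | B , B∈ , EB | _ , τB′∈ , EτB′ with ∈-map⁻ (act τ) τB′∈
    ... | B′ , B′∈ , refl = [ (λ B⊆B′ → u∉B′ (B⊆B′ (proj₁ (sep EB)))) , (λ B′⊆B → proj₂ (sep EB) (B′⊆B v∈B′)) ]′
              (sorted⇒comparable (path-sorted p) B∈ B′∈)
      where
      v∈B′ : v ∈ˢ B′
      v∈B′ = lookup⇒[]= v B′ (trans (sym (lookup-transposeˡ u v B′)) ([]=⇒lookup (proj₁ (sep EτB′))))
      u∉B′ : u ∉ˢ B′
      u∉B′ u∈ = proj₂ (sep EτB′) (lookup⇒[]= v _ (trans (lookup-transposeʳ u v B′) ([]=⇒lookup u∈)))

    pointwise : ∀ {C} → MaxChain C → g C + g (map (act τ) C) ≤ ⟦ A ∈? C ⟧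
    pointwise {C} p with A ∈? C
    ... | no A∉ = ≤-reflexive (cong (_* ⟦ any? E? (map (act τ) C) ⟧) (⟦⟧-no (A ∈? map (act τ) C) (A∉ ∘ from-image)))
    ... | yes _ with any? E? C
    ...   | no _ = *-mono-≤ (⟦⟧≤1 (A ∈? map (act τ) C)) (⟦⟧≤1 (any? E? (map (act τ) C)))
    ...   | yes hit = s≤s (≤-reflexive (trans (cong (⟦ A ∈? map (act τ) C ⟧ *_)
              (⟦⟧-no (any? E? (map (act τ) C)) (avoid p hit))) (*-zeroʳ ⟦ A ∈? map (act τ) C ⟧)))

-- Families whose members have a chain above them

comparable? : ∀ {n} → Decidable₂ (Comparable {n})
comparable? A B = (A ⊆? B) ⊎-dec (B ⊆? A)

# : ∀ {X : Set} {P : X → Set} → Decidable P → List X → ℕ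
# P? xs = ∑ xs λ x → ⟦ P? x ⟧

module _ {X : Set} {P : X → Set} (P? : Decidable P) where

  #-none : ∀ xs → ¬ Any P xs → # P? xs ≡ 0
  #-none xs ¬any = ∑-zero xs λ {x} x∈ → ⟦⟧-no (P? x) λ p → ¬any (lose x∈ p)

  #≤length : ∀ xs → # P? xs ≤ length xs
  #≤length xs = ≤-trans (∑-mono xs λ {x} _ → ⟦⟧≤1 (P? x)) (≤-reflexive (trans (∑-const xs 1) (*-identityʳ _)))

  #-filter : ∀ {Q : X → Set} (Q? : Decidable Q) → (∀ {x} → P x → Q x) → ∀ xs → # P? xs ≡ # P? (filter Q? xs)
  #-filter Q? P⇒Q [] = refl
  #-filter Q? P⇒Q (x ∷ xs) with Q? x
  ... | yes _ = cong (⟦ P? x ⟧ +_) (#-filter Q? P⇒Q xs)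
  ... | no ¬q = trans (cong (_+ # P? xs) (⟦⟧-no (P? x) (¬q ∘ P⇒Q))) (#-filter Q? P⇒Q xs)

AllPairs-reverse : ∀ {X : Set} {R : X → X → Set} {xs} → AllPairs R xs → AllPairs (flip R) (reverse xs)
AllPairs-reverse [] = []
AllPairs-reverse {R = R} {x ∷ xs} (rx ∷ ap) = subst (AllPairs (flip R)) (sym (unfold-reverse x xs))
  (APₚ.++⁺ (AllPairs-reverse ap) ([] ∷ [])
    (All.tabulate λ y∈ → All.lookup rx (∈-resp-↭ (↭-reverse xs) y∈) ∷ []))

AllPairs-last : ∀ {X : Set} {R : X → X → Set} {x xs} → AllPairs R (x ∷ xs) →
  ∃ λ m → m ∈ x ∷ xs × All (λ y → y ≡ m ⊎ R y m) (x ∷ xs)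
AllPairs-last {xs = []} _ = _ , here refl , inj₁ refl ∷ []
AllPairs-last {xs = _ ∷ _} (rx ∷ ap) with AllPairs-last ap
... | m , m∈ , le = m , there m∈ , inj₂ (All.lookup rx m∈) ∷ le

AllPairs-trichotomy : ∀ {X : Set} {R : X → X → Set} {xs x y} → AllPairs R xs → x ∈ xs → y ∈ xs → x ≡ y ⊎ R x y ⊎ R y x
AllPairs-trichotomy (_ ∷ _) (here refl) (here refl) = inj₁ refl
AllPairs-trichotomy (r ∷ _) (here refl) (there y∈) = inj₂ (inj₁ (All.lookup r y∈))
AllPairs-trichotomy (r ∷ _) (there x∈) (here refl) = inj₂ (inj₂ (All.lookup r x∈))
AllPairs-trichotomy (_ ∷ ap) (there x∈) (there y∈) = AllPairs-trichotomy ap x∈ y∈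

-- ≺ will be ⊂ or ⊃; in the latter case U is the set called D above.
module Direction {n : ℕ} (_≺_ : Subset n → Subset n → Set) (_≺?_ : Decidable₂ _≺_) (≺-trans : Transitive _≺_)
                 (Fs : List (Subset n)) where

  open DecMembership (_≟ˢ_ {n}) using (_∈?_)

  -- Stated positively: two members above a common chain of `s` members are comparable. For `⊃` this
  -- expresses the absence of `Y'_s`. The value `s = 1` is included because it arises from `k = 2`
  -- when `⊥` or `⊤` is removed.
  YFree : ℕ → Set
  YFree s = ∀ {xs y z} → AllPairs _≺_ xs → All (_∈ Fs) xs → length xs ≡ s → y ∈ Fs → z ∈ Fs →
            All (_≺ y) xs → All (_≺ z) xs → Comparable y z

  U : Subset n → Set
  U A = A ∈ Fs × All (λ B → All (λ B′ → A ≺ B → A ≺ B′ → Comparable B B′) Fs) Fs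

  U? : Decidable U
  U? A = (A ∈? Fs) ×-dec all? (λ B → all? (λ B′ → (A ≺? B) →-dec ((A ≺? B′) →-dec comparable? B B′)) Fs) Fs

  U-comparable : ∀ {A B B′} → U A → B ∈ Fs → B′ ∈ Fs → A ≺ B → A ≺ B′ → Comparable B B′
  U-comparable (_ , up) B∈ B′∈ = All.lookup (All.lookup up B∈) B′∈

  U-up : ∀ {A B} → U A → B ∈ Fs → A ≺ B → U B
  U-up UA B∈ A≺B = B∈ , All.tabulate λ X∈ → All.tabulate λ Y∈ B≺X B≺Y →
    U-comparable UA X∈ Y∈ (≺-trans A≺B B≺X) (≺-trans A≺B B≺Y)

  U-all : YFree 1 → ∀ {A} → A ∈ Fs → U A
  U-all free A∈ = A∈ , All.tabulate λ X∈ → All.tabulate λ Y∈ A≺X A≺Y →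
    free ([] ∷ []) (A∈ ∷ []) refl X∈ Y∈ (A≺X ∷ []) (A≺Y ∷ [])

  NonMax : Subset n → Set
  NonMax A = Any (A ≺_) Fs

  nonMax? : Decidable NonMax
  nonMax? A = any? (A ≺?_) Fs

  U°? : Decidable (λ A → U A × NonMax A)
  U°? A = U? A ×-dec nonMax? A

  N : Subset n → Set
  N A = A ∈ Fs × ¬ U A

  N? : Decidable N
  N? A = (A ∈? Fs) ×-dec ¬? (U? A)

  N-down : ∀ {A B} → A ∈ Fs → A ≺ B → N B → N A
  N-down A∈ A≺B (B∈ , ¬UB) = A∈ , λ UA → ¬UB (U-up UA B∈ A≺B)

  -- The top of an `s`-element chain in `N` is not in `U`, so it has two incomparable members of
  -- `Fs` above it; with the chain they would form a forbidden configuration. The condition `1 ≤ s`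
  -- ensures that there is a top.
  N-bound : ∀ {s xs} → YFree s → 1 ≤ s → AllPairs _≺_ xs → All N xs → length xs < s
  N-bound {s} {xs} free 1≤s ap ns = ≰⇒> λ s≤ → impossible (take s xs)
      (trans (length-take s xs) (m≤n⇒m⊓n≡m s≤)) (APₚ.take⁺ s ap) (Allₚ.take⁺ s ns)
    where
    impossible : ∀ ys → length ys ≡ s → AllPairs _≺_ ys → ¬ All N ys
    impossible [] refl _ _ = contradiction 1≤s λ ()
    impossible (y ∷ ys) len ap ns with AllPairs-last ap
    ... | m , m∈ , le = proj₂ Nm (proj₁ Nm , All.tabulate λ {B} B∈ → All.tabulate λ {B′} B′∈ m≺B m≺B′ →
        free ap (All.map proj₁ ns) len B∈ B′∈ (All.map (below m≺B) le) (All.map (below m≺B′) le))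
      where
      Nm = All.lookup ns m∈
      below : ∀ {B x} → m ≺ B → x ≡ m ⊎ x ≺ m → x ≺ B
      below m≺B (inj₁ refl) = m≺B
      below m≺B (inj₂ x≺m) = ≺-trans x≺m m≺B

  -- Either the lowest member of N on the chain is not counted by Q, or the chain can be extended below it.
  N-bound-2 : ∀ {s xs} {Q : Subset n → Set} (Q? : Decidable Q) → YFree s → 1 ≤ s → AllPairs _≺_ xs →
    (∀ {A} → Q A → N A) → Any N xs →
    (∀ {H} → H ∈ xs → All (λ X → X ≡ H ⊎ H ≺ X) (filter N? xs) → Q H → Any (_≺ H) Fs) →
    # Q? xs + 2 ≤ s
  N-bound-2 {s} {xs} {Q} Q? free 1≤s ap Q⇒N any-N bottom =
    subst (λ m → m + 2 ≤ s) (sym (#-filter Q? N? Q⇒N xs))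
      (go (filter N? xs) (APₚ.filter⁺ N? ap) (all-filter N? xs) (λ x∈ → proj₁ (∈-filter⁻ N? x∈)) nonempty bottom)
    where
    nonempty : ∃ λ x → x ∈ filter N? xs
    nonempty = let x , x∈ , Nx = find any-N in x , ∈-filter⁺ N? x∈ Nx
    go : ∀ ys → AllPairs _≺_ ys → All N ys → (∀ {x} → x ∈ ys → x ∈ xs) → (∃ λ x → x ∈ ys) →
         (∀ {H} → H ∈ xs → All (λ X → X ≡ H ⊎ H ≺ X) ys → Q H → Any (_≺ H) Fs) → # Q? ys + 2 ≤ s
    go [] _ _ _ (_ , ()) _
    go (H ∷ T) ap@(lt ∷ _) ns sub _ bot with Q? H
    ... | no _ = ≤-trans (+-monoˡ-≤ 2 (#≤length Q? T)) (≤-trans (≤-reflexive (+-comm (length T) 2)) (N-bound free 1≤s ap ns))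
    ... | yes q with find (bot (sub (here refl)) (inj₁ refl ∷ All.map inj₂ lt) q)
    ...   | B , B∈ , B≺H = ≤-trans (s≤s (+-monoˡ-≤ 2 (#≤length Q? T)))
              (≤-trans (s≤s (≤-reflexive (+-comm (length T) 2)))
                (N-bound free 1≤s ((B≺H ∷ All.map (≺-trans B≺H) lt) ∷ ap) (N-down B∈ B≺H (All.head ns) ∷ ns)))

  Above : Subset n → Subset n → Set
  Above A B = U B × A ≺ B

  above? : ∀ A → Decidable (Above A)
  above? A B = U? B ×-dec (A ≺? B)

  -- Every member of `U` on the chain except the topmost one has another above it. The induction
  -- shortens `xs`, while the members above are always sought in the whole chain `C`.
  #U≤ : ∀ C xs → AllPairs _≺_ xs → (∀ {x} → x ∈ xs → x ∈ C) →
    # U? xs ≤ ⟦ any? U? xs ⟧ + ∑ xs (λ A → ⟦ U? A ⟧ * ⟦ any? (above? A) C ⟧)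
  #U≤ C [] _ _ = z≤n
  #U≤ C (x ∷ xs) (lt ∷ ap) sub = bound (U? x) (any? U? xs) refl
    where
    S : ℕ
    S = ∑ xs (λ A → ⟦ U? A ⟧ * ⟦ any? (above? A) C ⟧)
    ih : # U? xs ≤ ⟦ any? U? xs ⟧ + S
    ih = #U≤ C xs ap (sub ∘ there)
    a = ⟦ any? (above? x) C ⟧
    bound : (d : Dec (U x)) (e : Dec (Any U xs)) → ⟦ e ⟧ ≡ ⟦ any? U? xs ⟧ →
            ⟦ U? x ⟧ + # U? xs ≤ ⟦ any? U? (x ∷ xs) ⟧ + (⟦ U? x ⟧ * a + S)
    bound (no ¬Ux) e _ rewrite ⟦⟧-no (U? x) ¬Ux =
      ≤-trans ih (+-monoˡ-≤ S (⟦⟧-mono (any? U? xs) (any? U? (x ∷ xs)) there))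
    bound (yes Ux) (no ¬any) _ rewrite ⟦⟧-yes (U? x) Ux | ⟦⟧-yes (any? U? (x ∷ xs)) (here Ux) | #-none U? xs ¬any = s≤s z≤n
    bound (yes Ux) (yes hit) eq rewrite ⟦⟧-yes (U? x) Ux | ⟦⟧-yes (any? U? (x ∷ xs)) (here Ux)
      | ⟦⟧-yes (any? (above? x) C) (let B , B∈ , UB = find hit in lose (sub (there B∈)) (UB , All.lookup lt B∈)) =
      s≤s (≤-trans ih (+-monoˡ-≤ S (⟦⟧≤1 (any? U? xs))))

  -- The assumptions `half≺` and `sort` are the facts that need a separate proof for `⊂` and for
  -- `⊃`.
  module _ (uniq : Unique Fs)
           (half≺ : ∀ {A} → U A → NonMax A →
             2 * ∑ᶜ (λ C → ⟦ A ∈? C ⟧ * ⟦ any? (above? A) C ⟧) ≤ ∑ᶜ (λ C → ⟦ A ∈? C ⟧))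
           (sort : ∀ {C} → MaxChain C → ∃ λ xs → xs ↭ C × AllPairs _≺_ xs) where

    -- After summing `#U≤` over all chains and exchanging sums, each `A` in `U` counts the chains
    -- through it that meet `U` above it. These are at most half of the chains through `A` if it is
    -- not maximal, and none if it is.
    ∑ᶜ-U : 2 * ∑ᶜ (# U?) ≤ ∑ᶜ (# U°?) + 2 * ∑ᶜ (λ C → ⟦ any? U? C ⟧)
    ∑ᶜ-U = begin
        2 * ∑ᶜ (# U?)
          ≤⟨ *-monoʳ-≤ 2 (∑ᵖ-mono n ⊥ pointwise) ⟩
        2 * ∑ᶜ (λ C → ⟦ any? U? C ⟧ + ∑ Fs (λ A → ⟦ A ∈? C ⟧ * (⟦ U? A ⟧ * υ A C)))
          ≡⟨ cong (2 *_) (∑ᵖ-+ n ⊥ _ _) ⟩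
        2 * (hits + ∑ᶜ (λ C → ∑ Fs (λ A → ⟦ A ∈? C ⟧ * (⟦ U? A ⟧ * υ A C))))
          ≡⟨ *-distribˡ-+ 2 hits _ ⟩
        2 * hits + 2 * ∑ᶜ (λ C → ∑ Fs (λ A → ⟦ A ∈? C ⟧ * (⟦ U? A ⟧ * υ A C)))
          ≡⟨ +-comm (2 * hits) _ ⟩
        2 * ∑ᶜ (λ C → ∑ Fs (λ A → ⟦ A ∈? C ⟧ * (⟦ U? A ⟧ * υ A C))) + 2 * hits
          ≡⟨ cong (λ m → 2 * m + 2 * hits) (∑ᵖ-∑ n ⊥ Fs _) ⟩
        2 * ∑ Fs (λ A → ∑ᶜ (λ C → ⟦ A ∈? C ⟧ * (⟦ U? A ⟧ * υ A C))) + 2 * hits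
          ≡⟨ cong (_+ 2 * hits) (sym (∑-*ˡ Fs 2 _)) ⟩
        ∑ Fs (λ A → 2 * ∑ᶜ (λ C → ⟦ A ∈? C ⟧ * (⟦ U? A ⟧ * υ A C))) + 2 * hits
          ≤⟨ +-monoˡ-≤ (2 * hits) (∑-mono Fs λ {A} A∈ → element A (U? A) (nonMax? A)) ⟩
        ∑ Fs (λ A → ∑ᶜ (λ C → ⟦ A ∈? C ⟧ * ⟦ U°? A ⟧)) + 2 * hits
          ≡⟨ cong (_+ 2 * hits) (sym (∑ᵖ-∑ n ⊥ Fs _)) ⟩
        ∑ᶜ (λ C → ∑ Fs (λ A → ⟦ A ∈? C ⟧ * ⟦ U°? A ⟧)) + 2 * hits
          -- The sum over members through which a chain passes becomes a sum along the chain; the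
          -- indicator of `Fs` disappears because `U` lies in `Fs`.
          ≡⟨ cong (_+ 2 * hits) (∑ᵖ-cong n ⊥ λ {C} p → trans
               (∑-∈-swap _≟ˢ_ (λ A → ⟦ U°? A ⟧) uniq (sorted⇒unique (path-sorted p)))
               (∑-cong C λ {A} _ → absorb A (U°? A) (proj₁ ∘ proj₁))) ⟩
        ∑ᶜ (# U°?) + 2 * hits ∎
      where
      open ≤-Reasoning
      υ : Subset n → List (Subset n) → ℕ
      υ A C = ⟦ any? (above? A) C ⟧
      hits = ∑ᶜ (λ C → ⟦ any? U? C ⟧)

      absorb : ∀ {P : Set} A (d : Dec P) → (P → A ∈ Fs) → ⟦ A ∈? Fs ⟧ * ⟦ d ⟧ ≡ ⟦ d ⟧
      absorb A (yes p) f = trans (*-identityʳ _) (⟦⟧-yes (A ∈? Fs) (f p))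
      absorb A (no _) f = *-zeroʳ ⟦ A ∈? Fs ⟧

      pointwise : ∀ {C} → MaxChain C →
        # U? C ≤ ⟦ any? U? C ⟧ + ∑ Fs (λ A → ⟦ A ∈? C ⟧ * (⟦ U? A ⟧ * υ A C))
      pointwise {C} p with sort p
      ... | xs , xs↭C , ap = begin
        # U? C                                                 ≡⟨ sym (∑-↭ _ xs↭C) ⟩
        # U? xs                                                ≤⟨ #U≤ C xs ap (∈-resp-↭ xs↭C) ⟩
        ⟦ any? U? xs ⟧ + ∑ xs (λ A → ⟦ U? A ⟧ * υ A C)          ≡⟨ cong₂ _+_
            (⟦⟧-cong (any? U? xs) (any? U? C) (Any-resp-↭ xs↭C) (Any-resp-↭ (↭-sym xs↭C)))
            (∑-↭ _ xs↭C) ⟩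
        ⟦ any? U? C ⟧ + ∑ C (λ A → ⟦ U? A ⟧ * υ A C)            ≡⟨ cong (⟦ any? U? C ⟧ +_) (trans
            (∑-cong C λ {A} _ → trans (cong (_* υ A C) (sym (absorb A (U? A) proj₁))) (*-assoc ⟦ A ∈? Fs ⟧ ⟦ U? A ⟧ (υ A C)))
            (∑-∈-swap _≟ˢ_ (λ A → ⟦ U? A ⟧ * υ A C) (sorted⇒unique (path-sorted p)) uniq)) ⟩
        ⟦ any? U? C ⟧ + ∑ Fs (λ A → ⟦ A ∈? C ⟧ * (⟦ U? A ⟧ * υ A C)) ∎

      vanish : ∀ A → (∀ C → ⟦ U? A ⟧ * υ A C ≡ 0) → 2 * ∑ᶜ (λ C → ⟦ A ∈? C ⟧ * (⟦ U? A ⟧ * υ A C)) ≤ 0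
      vanish A eq = ≤-reflexive (trans (cong (2 *_) (trans
        (∑ᵖ-cong n ⊥ λ {C} _ → trans (cong (⟦ A ∈? C ⟧ *_) (eq C)) (*-zeroʳ ⟦ A ∈? C ⟧))
        (∑ᵖ-*ˡ n ⊥ 0 λ _ → 0))) (*-zeroʳ 2))

      element : ∀ A → Dec (U A) → Dec (NonMax A) →
        2 * ∑ᶜ (λ C → ⟦ A ∈? C ⟧ * (⟦ U? A ⟧ * υ A C)) ≤ ∑ᶜ (λ C → ⟦ A ∈? C ⟧ * ⟦ U°? A ⟧)
      element A (no ¬UA) _ = ≤-trans (vanish A λ C → cong (_* υ A C) (⟦⟧-no (U? A) ¬UA)) z≤n
      element A (yes UA) (no max) = ≤-trans (vanish A λ C → trans
        (cong (⟦ U? A ⟧ *_) (⟦⟧-no (any? (above? A) C) λ hit →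
          let B , _ , (B∈ , _) , A≺B = find hit in max (lose B∈ A≺B)))
        (*-zeroʳ ⟦ U? A ⟧)) z≤n
      element A (yes UA) (yes nm) = begin
        2 * ∑ᶜ (λ C → ⟦ A ∈? C ⟧ * (⟦ U? A ⟧ * υ A C)) ≡⟨ cong (2 *_) (∑ᵖ-cong n ⊥ λ {C} _ → cong (⟦ A ∈? C ⟧ *_)
                                                        (trans (cong (_* υ A C) (⟦⟧-yes (U? A) UA)) (*-identityˡ _))) ⟩
        2 * ∑ᶜ (λ C → ⟦ A ∈? C ⟧ * υ A C)              ≤⟨ half≺ UA nm ⟩
        ∑ᶜ (λ C → ⟦ A ∈? C ⟧)                          ≡⟨ ∑ᵖ-cong n ⊥ (λ {C} _ → sym (trans
                                                        (cong (⟦ A ∈? C ⟧ *_) (⟦⟧-yes (U°? A) (UA , nm))) (*-identityʳ _))) ⟩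
        ∑ᶜ (λ C → ⟦ A ∈? C ⟧ * ⟦ U°? A ⟧)              ∎

module Side {n : ℕ} (_≺_ : Subset n → Subset n → Set) (_≺?_ : Decidable₂ _≺_) (≺-trans : Transitive _≺_)
            (Fs : List (Subset n)) where

  module Fwd = Direction _≺_ _≺?_ ≺-trans Fs
  module Bwd = Direction (flip _≺_) (flip _≺?_) (λ p q → ≺-trans q p) Fs

  -- For ≺ = ⊂ this is (D° ∖ U) ∪ R.
  Q : Subset n → Set
  Q A = Fwd.N A × (¬ Bwd.U A ⊎ Bwd.NonMax A)

  Q? : Decidable Q
  Q? A = Fwd.N? A ×-dec (¬? (Bwd.U? A) ⊎-dec Bwd.nonMax? A)

  -- For `≺ = ⊂`, `Fwd.U` is U and `Bwd.U` is D. A chain that avoids D has fewer than `s` members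
  -- outside U; one that meets D has to lose two from `s`, and the cases depend on whether it meets
  -- D outside U.
  #Q-bound : ∀ {s xs} → Fwd.YFree s → 2 ≤ s → AllPairs _≺_ xs → # Q? xs + 2 * ⟦ any? Bwd.U? xs ⟧ ≤ s
  #Q-bound {s} {xs} free 2≤s ap with any? Bwd.U? xs
  ... | no _ = begin
      # Q? xs + 0            ≡⟨ +-identityʳ _ ⟩
      # Q? xs                ≡⟨ #-filter Q? Fwd.N? proj₁ xs ⟩
      # Q? (filter Fwd.N? xs) ≤⟨ #≤length Q? (filter Fwd.N? xs) ⟩
      length (filter Fwd.N? xs) <⟨ Fwd.N-bound free (<⇒≤ 2≤s) (APₚ.filter⁺ Fwd.N? ap) (all-filter Fwd.N? xs) ⟩
      s ∎
    where open ≤-Reasoning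
  ... | yes D-hit with any? (λ A → Bwd.U? A ×-dec Fwd.N? A) xs
  -- The lowest member `H` outside U is at or below a member of D, so it is in D as well. If `Q`
  -- counts `H`, then `H` is not minimal, and the chain can be extended below it.
  ...   | yes DN-hit = Fwd.N-bound-2 Q? free (<⇒≤ 2≤s) ap proj₁ (Any.map proj₂ DN-hit) bottom
    where
    bottom : ∀ {H} → H ∈ xs → All (λ X → X ≡ H ⊎ H ≺ X) (filter Fwd.N? xs) → Q H → Any (_≺ H) Fs
    bottom {H} H∈ low ((H∈F , _) , or) with find DN-hit
    ... | P , P∈ , DP , NP with or
    ...   | inj₂ nm = nm
    ...   | inj₁ ¬DH with All.lookup low (∈-filter⁺ Fwd.N? P∈ NP)
    ...     | inj₁ refl = contradiction DP ¬DH
    ...     | inj₂ H≺P = contradiction (Bwd.U-up DP H∈F H≺P) ¬DH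
  -- A member `m` of D on the chain must be in U. Members of `Fs` on the chain above `m` are then in
  -- U; those below `m` are in D and hence, in this case, also in U. So `Q` counts nothing, and
  -- `2 ≤ s` suffices.
  ...   | no ¬DN-hit = ≤-trans (≤-reflexive (cong (_+ 2) (#-none Q? xs none))) 2≤s
    where
    none : ¬ Any Q xs
    none hit with find hit | find D-hit
    ... | X , X∈ , NX , _ | m , m∈ , Dm = ¬DN-hit (lose X∈ (DX , NX))
      where
      Um : Fwd.U m
      Um = decidable-stable (Fwd.U? m) λ ¬Um → ¬DN-hit (lose m∈ (Dm , proj₁ Dm , ¬Um))
      DX : Bwd.U X
      DX with AllPairs-trichotomy ap X∈ m∈
      ... | inj₁ refl = Dm
      ... | inj₂ (inj₁ X≺m) = Bwd.U-up Dm (proj₁ NX) X≺m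
      ... | inj₂ (inj₂ m≺X) = contradiction (Fwd.U-up Um (proj₁ NX) m≺X) (proj₂ NX)

-- Least and greatest members of a chain

least : ∀ {n} (B : Subset n) Bs → (∀ {X Y} → X ∈ B ∷ Bs → Y ∈ B ∷ Bs → Comparable X Y) →
        ∃ λ m → m ∈ B ∷ Bs × (∀ {X} → X ∈ B ∷ Bs → m ⊆ˢ X)
least B [] _ = B , here refl , λ { (here refl) → ⊆-refl }
least B (B′ ∷ Bs) cmp with least B′ Bs (λ X∈ Y∈ → cmp (there X∈) (there Y∈))
... | m , m∈ , low with cmp (here refl) (there m∈)
...   | inj₁ B⊆m = B , here refl , λ { (here refl) → ⊆-refl ; (there X∈) → ⊆-trans B⊆m (low X∈) }
...   | inj₂ m⊆B = m , there m∈ , λ { (here refl) → m⊆B ; (there X∈) → low X∈ }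

greatest : ∀ {n} (B : Subset n) Bs → (∀ {X Y} → X ∈ B ∷ Bs → Y ∈ B ∷ Bs → Comparable X Y) →
           ∃ λ m → m ∈ B ∷ Bs × (∀ {X} → X ∈ B ∷ Bs → X ⊆ˢ m)
greatest B [] _ = B , here refl , λ { (here refl) → ⊆-refl }
greatest B (B′ ∷ Bs) cmp with greatest B′ Bs (λ X∈ Y∈ → cmp (there X∈) (there Y∈))
... | m , m∈ , high with cmp (here refl) (there m∈)
...   | inj₁ B⊆m = m , there m∈ , λ { (here refl) → B⊆m ; (there X∈) → high X∈ }
...   | inj₂ m⊆B = B , here refl , λ { (here refl) → ⊆-refl ; (there X∈) → ⊆-trans (high X∈) m⊆B }

extremes : ∀ {n} {P : Subset n → Set} (P? : Decidable P) Fs → Any P Fs →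
  (∀ {X Y} → X ∈ Fs → Y ∈ Fs → P X → P Y → Comparable X Y) →
  ∃₂ λ m g → m ∈ Fs × P m × g ∈ Fs × P g × (∀ {X} → X ∈ Fs → P X → m ⊆ˢ X × X ⊆ˢ g)
extremes {P = P} P? Fs hit cmp with filter P? Fs in eq
... | [] = let x , x∈ , px = find hit in
           contradiction (subst (x ∈_) eq (∈-filter⁺ P? x∈ px)) λ ()
... | B ∷ Bs = let m , m∈ , low = least B Bs cmp′ ; g , g∈ , high = greatest B Bs cmp′
                   m∈F , Pm = back m∈ ; g∈F , Pg = back g∈
               in m , g , m∈F , Pm , g∈F , Pg , λ X∈ PX →
                  let X∈′ = subst (_ ∈_) eq (∈-filter⁺ P? X∈ PX) in low X∈′ , high X∈′
  where
  back : ∀ {X} → X ∈ B ∷ Bs → X ∈ Fs × P X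
  back X∈ = ∈-filter⁻ P? (subst (_ ∈_) (sym eq) X∈)
  cmp′ : ∀ {X Y} → X ∈ B ∷ Bs → Y ∈ B ∷ Bs → Comparable X Y
  cmp′ X∈ Y∈ = cmp (proj₁ (back X∈)) (proj₁ (back Y∈)) (proj₂ (back X∈)) (proj₂ (back Y∈))

≢⊤⇒∃∉ : ∀ {n} {A : Subset n} → A ≢ ⊤ → ∃ λ v → v ∉ˢ A
≢⊤⇒∃∉ {n} {A} A≢⊤ = ¬∀⟶∃¬ n (_∈ˢ A) (_∈ˢ? A) λ all → A≢⊤ (⊆-antisym ⊆⊤ λ {x} _ → all x)

≢⊥⇒∃∈ : ∀ {n} {A : Subset n} → A ≢ ⊥ → ∃ λ u → u ∈ˢ A
≢⊥⇒∃∈ {A = A} A≢⊥ with nonempty? A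
... | yes ne = ne
... | no empty = contradiction (Empty-unique empty) A≢⊥

-- From chain counts to weights, and the one-sided LYM inequality

module Weights {n : ℕ} (Fs : List (Subset n)) (uniq : Unique Fs) where

  open DecMembership (_≟ˢ_ {n}) using (_∈?_)

  #F : List (Subset n) → ℕ
  #F = # (_∈? Fs)

  -- Double counting of the pairs of a member and a maximal chain through it.
  ∑-weight≤ : ∀ {P : Subset n → Set} (P? : Decidable P) →
    ∑ Fs (λ A → ⟦ P? A ⟧ * weight A) ≤ ∑ᶜ (λ C → ∑ C (λ A → ⟦ A ∈? Fs ⟧ * ⟦ P? A ⟧))
  ∑-weight≤ P? = begin
      ∑ Fs (λ A → ⟦ P? A ⟧ * weight A)                      ≤⟨ ∑-mono Fs (λ {A} _ → *-monoʳ-≤ ⟦ P? A ⟧ (weight≤∑ᶜ A)) ⟩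
      ∑ Fs (λ A → ⟦ P? A ⟧ * ∑ᶜ (λ C → ⟦ A ∈? C ⟧))         ≡⟨ ∑-cong Fs (λ {A} _ → sym (∑ᵖ-*ˡ n ⊥ ⟦ P? A ⟧ _)) ⟩
      ∑ Fs (λ A → ∑ᶜ (λ C → ⟦ P? A ⟧ * ⟦ A ∈? C ⟧))         ≡⟨ sym (∑ᵖ-∑ n ⊥ Fs _) ⟩
      ∑ᶜ (λ C → ∑ Fs (λ A → ⟦ P? A ⟧ * ⟦ A ∈? C ⟧))         ≡⟨ ∑ᵖ-cong n ⊥ (λ {C} p → trans
                                                               (∑-cong Fs λ {A} _ → *-comm ⟦ P? A ⟧ _)
                                                               (∑-∈-swap _≟ˢ_ (λ A → ⟦ P? A ⟧) uniq (sorted⇒unique (path-sorted p)))) ⟩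
      ∑ᶜ (λ C → ∑ C (λ A → ⟦ A ∈? Fs ⟧ * ⟦ P? A ⟧)) ∎
    where open ≤-Reasoning

  ∑-weight≤#F : ∑ Fs weight ≤ ∑ᶜ #F
  ∑-weight≤#F = begin
      ∑ Fs weight                            ≡⟨ ∑-cong Fs (λ {A} _ → sym (*-identityˡ (weight A))) ⟩
      ∑ Fs (λ A → 1 * weight A)              ≤⟨ ∑-weight≤ {P = λ _ → Unit} (λ _ → yes tt) ⟩
      ∑ᶜ (λ C → ∑ C (λ A → ⟦ A ∈? Fs ⟧ * 1)) ≡⟨ ∑ᵖ-cong n ⊥ (λ {C} _ → ∑-cong C λ _ → *-identityʳ _) ⟩
      ∑ᶜ #F ∎
    where open ≤-Reasoning

  module _ (_≺_ : Subset n → Subset n → Set) (_≺?_ : Decidable₂ _≺_) (≺-trans : Transitive _≺_) where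

    open Direction _≺_ _≺?_ ≺-trans Fs

    max? : Decidable (λ A → ¬ NonMax A)
    max? A = ¬? (nonMax? A)

    -- Here `U` is all of `Fs`, and a member not counted by `U°?` is maximal. Adding the count of
    -- maximal members to both sides of the given bound therefore turns `# U°?` into `#F`, which
    -- cancels one of the two copies on the left.
    oneSided-LYM : 2 * ∑ᶜ (# U?) ≤ ∑ᶜ (# U°?) + 2 * ∑ᶜ (λ C → ⟦ any? U? C ⟧) → YFree 1 →
      ∑ Fs weight + ∑ Fs (λ A → ⟦ max? A ⟧ * weight A) ≤ 2 * n !
    oneSided-LYM bound free = ≤-trans (+-mono-≤ ∑-weight≤#F (∑-weight≤ max?)) (+-cancelˡ-≤ (∑ᶜ #F) _ _ (begin
        ∑ᶜ #F + (∑ᶜ #F + ∑ᶜ #Max)                              ≡⟨ sym (+-assoc (∑ᶜ #F) _ _) ⟩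
        ∑ᶜ #F + ∑ᶜ #F + ∑ᶜ #Max                                ≡⟨ cong (λ m → ∑ᶜ #F + m + ∑ᶜ #Max) (sym (+-identityʳ _)) ⟩
        2 * ∑ᶜ #F + ∑ᶜ #Max                                    ≡⟨ cong (λ m → 2 * m + ∑ᶜ #Max) (∑ᵖ-cong n ⊥ λ {C} _ → ∑-cong C λ {A} _ →
                                                                    ⟦⟧-cong (A ∈? Fs) (U? A) (U-all free) proj₁) ⟩
        2 * ∑ᶜ (# U?) + ∑ᶜ #Max                                ≤⟨ +-monoˡ-≤ (∑ᶜ #Max) bound ⟩
        ∑ᶜ (# U°?) + 2 * ∑ᶜ (λ C → ⟦ any? U? C ⟧) + ∑ᶜ #Max    ≤⟨ +-monoˡ-≤ (∑ᶜ #Max) (+-monoʳ-≤ (∑ᶜ (# U°?)) (*-monoʳ-≤ 2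
                                                                    (∑ᵖ-mono n ⊥ λ {C} _ → ⟦⟧≤1 (any? U? C)))) ⟩
        ∑ᶜ (# U°?) + 2 * ∑ᶜ {n} (λ _ → 1) + ∑ᶜ #Max            ≡⟨ cong (λ m → ∑ᶜ (# U°?) + 2 * m + ∑ᶜ #Max) (trans (∑ᶜ-const {n} 1) (*-identityʳ (n !))) ⟩
        ∑ᶜ (# U°?) + 2 * n ! + ∑ᶜ #Max                         ≡⟨ solve 3 (λ a b c → a :+ b :+ c := a :+ c :+ b) refl (∑ᶜ (# U°?)) (2 * n !) (∑ᶜ #Max) ⟩
        ∑ᶜ (# U°?) + ∑ᶜ #Max + 2 * n !                         ≡⟨ cong (_+ 2 * n !) (trans (sym (∑ᵖ-+ n ⊥ (# U°?) #Max))
                                                                    (∑ᵖ-cong n ⊥ λ {C} _ → trans (sym (∑-+ C _ _)) (∑-cong C λ {A} _ →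
                                                                      split (A ∈? Fs) (U? A) (nonMax? A) (U-all free) proj₁))) ⟩
        ∑ᶜ #F + 2 * n ! ∎))
      where
      open ≤-Reasoning
      open +-*-Solver using (solve; _:+_; _:=_)
      #Max : List (Subset n) → ℕ
      #Max C = ∑ C (λ A → ⟦ A ∈? Fs ⟧ * ⟦ max? A ⟧)
      split : ∀ {F V M : Set} (f : Dec F) (u : Dec V) (m : Dec M) → (F → V) → (V → F) →
              ⟦ u ×-dec m ⟧ + ⟦ f ⟧ * ⟦ ¬? m ⟧ ≡ ⟦ f ⟧
      split (yes _) (yes _) (yes _) _ _ = refl
      split (yes _) (yes _) (no _) _ _ = refl
      split (yes f) (no ¬u) _ F⇒U _ = contradiction (F⇒U f) ¬u
      split (no ¬f) (yes u) _ _ U⇒F = contradiction (U⇒F u) ¬f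
      split (no _) (no _) _ _ _ = refl

-- The two-sided LYM inequality for families without the empty and the full set

module TwoSided {n : ℕ} (Fs : List (Subset n)) (uniq : Unique Fs) (⊥∉ : ⊥ ∉ Fs) (⊤∉ : ⊤ ∉ Fs) where

  open DecMembership (_≟ˢ_ {n}) using (_∈?_)

  open Weights Fs uniq

  module Up = Side _⊂_ _⊂?_ ⊂-trans Fs
  module Down = Side (flip _⊂_) (flip _⊂?_) (λ p q → ⊂-trans q p) Fs
  module ↑ = Up.Fwd
  module ↓ = Down.Fwd

  -- The element `u` comes from the least member `m` above `A`, and `v` from outside the greatest
  -- one `g`, which is not `⊤`. Both lie outside `A`, so transposing them fixes `A`.
  half↑ : ∀ {A} → ↑.U A → ↑.NonMax A →
    2 * ∑ᶜ (λ C → ⟦ A ∈? C ⟧ * ⟦ any? (↑.above? A) C ⟧) ≤ ∑ᶜ (λ C → ⟦ A ∈? C ⟧)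
  half↑ {A} UA nm with extremes (A ⊂?_) Fs nm (↑.U-comparable UA)
  ... | m , g , m∈ , (_ , u , u∈m , u∉A) , g∈ , (A⊆g , _) , between with ≢⊤⇒∃∉ {A = g} (λ { refl → ⊤∉ g∈ })
  ...   | v , v∉g = half (↑.above? A) A u v
            (trans (∉⇒lookup-false u∉A) (sym (∉⇒lookup-false (v∉g ∘ A⊆g))))
            λ { ((B∈ , _) , A⊂B) → proj₁ (between B∈ A⊂B) u∈m , v∉g ∘ proj₂ (between B∈ A⊂B) }

  -- Dually, `u` lies in the least member below `A`, which is not `⊥`, and `v` in `A` but outside
  -- the greatest one. Here both lie in `A`.
  half↓ : ∀ {A} → ↓.U A → ↓.NonMax A →
    2 * ∑ᶜ (λ C → ⟦ A ∈? C ⟧ * ⟦ any? (↓.above? A) C ⟧) ≤ ∑ᶜ (λ C → ⟦ A ∈? C ⟧)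
  half↓ {A} DA nm with extremes (_⊂? A) Fs nm (↓.U-comparable DA)
  ... | m , g , m∈ , (m⊆A , _) , g∈ , (_ , v , v∈A , v∉g) , between with ≢⊥⇒∃∈ {A = m} (λ { refl → ⊥∉ m∈ })
  ...   | u , u∈m = half (↓.above? A) A u v
            (trans ([]=⇒lookup (m⊆A u∈m)) (sym ([]=⇒lookup v∈A)))
            λ { ((B∈ , _) , B⊂A) → proj₁ (between B∈ B⊂A) u∈m , v∉g ∘ proj₂ (between B∈ B⊂A) }

  ∑ᶜ-↑ : 2 * ∑ᶜ (# ↑.U?) ≤ ∑ᶜ (# ↑.U°?) + 2 * ∑ᶜ (λ C → ⟦ any? ↑.U? C ⟧)
  ∑ᶜ-↑ = ↑.∑ᶜ-U uniq half↑ λ {C} p → C , ↭-refl , path-sorted p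

  ∑ᶜ-↓ : 2 * ∑ᶜ (# ↓.U?) ≤ ∑ᶜ (# ↓.U°?) + 2 * ∑ᶜ (λ C → ⟦ any? ↓.U? C ⟧)
  ∑ᶜ-↓ = ↓.∑ᶜ-U uniq half↓ λ {C} p → reverse C , ↭-reverse C , AllPairs-reverse (path-sorted p)

  M? : Decidable (λ A → ↑.U A × ↓.U A)
  M? A = ↑.U? A ×-dec ↓.U? A

  R? : Decidable (λ A → ↑.N A × ¬ ↓.U A)
  R? A = ↑.N? A ×-dec ¬? (↓.U? A)

  #F+#M : ∀ C → #F C + # M? C ≡ # ↑.U? C + # ↓.U? C + # R? C
  #F+#M C = begin
      #F C + # M? C ≡⟨ sym (∑-+ C _ _) ⟩
      ∑ C (λ A → ⟦ A ∈? Fs ⟧ + ⟦ M? A ⟧) ≡⟨ ∑-cong C (λ {A} _ → lemma (A ∈? Fs) (↑.U? A) (↓.U? A) proj₁ proj₁) ⟩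
      ∑ C (λ A → ⟦ ↑.U? A ⟧ + ⟦ ↓.U? A ⟧ + ⟦ R? A ⟧) ≡⟨ ∑-+ C _ _ ⟩
      ∑ C (λ A → ⟦ ↑.U? A ⟧ + ⟦ ↓.U? A ⟧) + # R? C ≡⟨ cong (_+ # R? C) (∑-+ C _ _) ⟩
      # ↑.U? C + # ↓.U? C + # R? C ∎
    where
    open ≡-Reasoning
    lemma : ∀ {F U D : Set} (f : Dec F) (u : Dec U) (d : Dec D) → (U → F) → (D → F) →
            ⟦ f ⟧ + ⟦ u ×-dec d ⟧ ≡ ⟦ u ⟧ + ⟦ d ⟧ + ⟦ (f ×-dec ¬? u) ×-dec ¬? d ⟧
    lemma (yes _) (yes _) (yes _) _ _ = refl
    lemma (yes _) (yes _) (no _) _ _ = refl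
    lemma (yes _) (no _) (yes _) _ _ = refl
    lemma (yes _) (no _) (no _) _ _ = refl
    lemma (no ¬f) (yes u) _ U⇒F _ = contradiction (U⇒F u) ¬f
    lemma (no ¬f) (no _) (yes d) _ D⇒F = contradiction (D⇒F d) ¬f
    lemma (no _) (no _) (no _) _ _ = refl

  -- Holds member by member: a member of U and D is paid for by `2 * # M? C`, a non-maximal one of U
  -- outside D by `Down.Q?`, a non-minimal one of D outside U by `Up.Q?`, and one of R by both.
  #°-bound : ∀ C → # ↑.U°? C + # ↓.U°? C + 2 * # R? C ≤ 2 * # M? C + # Up.Q? C + # Down.Q? C
  #°-bound C = begin
      # ↑.U°? C + # ↓.U°? C + 2 * # R? C
        ≡⟨ cong₂ _+_ (sym (∑-+ C _ _)) (sym (∑-*ˡ C 2 _)) ⟩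
      ∑ C (λ A → ⟦ ↑.U°? A ⟧ + ⟦ ↓.U°? A ⟧) + ∑ C (λ A → 2 * ⟦ R? A ⟧)
        ≡⟨ sym (∑-+ C _ _) ⟩
      ∑ C (λ A → ⟦ ↑.U°? A ⟧ + ⟦ ↓.U°? A ⟧ + 2 * ⟦ R? A ⟧)
        ≤⟨ ∑-mono C (λ {A} _ → lemma (A ∈? Fs) (↑.U? A) (↓.U? A) (↑.nonMax? A) (↓.nonMax? A) proj₁ proj₁) ⟩
      ∑ C (λ A → 2 * ⟦ M? A ⟧ + ⟦ Up.Q? A ⟧ + ⟦ Down.Q? A ⟧)
        ≡⟨ trans (∑-+ C _ _) (cong (_+ # Down.Q? C) (∑-+ C _ _)) ⟩
      ∑ C (λ A → 2 * ⟦ M? A ⟧) + # Up.Q? C + # Down.Q? C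
        ≡⟨ cong (λ m → m + # Up.Q? C + # Down.Q? C) (∑-*ˡ C 2 _) ⟩
      2 * # M? C + # Up.Q? C + # Down.Q? C ∎
    where
    open ≤-Reasoning
    lemma : ∀ {F U D A B : Set} (f : Dec F) (u : Dec U) (d : Dec D) (a : Dec A) (b : Dec B) → (U → F) → (D → F) →
            ⟦ u ×-dec a ⟧ + ⟦ d ×-dec b ⟧ + 2 * ⟦ (f ×-dec ¬? u) ×-dec ¬? d ⟧ ≤
            2 * ⟦ u ×-dec d ⟧ + ⟦ (f ×-dec ¬? u) ×-dec (¬? d ⊎-dec b) ⟧ + ⟦ (f ×-dec ¬? d) ×-dec (¬? u ⊎-dec a) ⟧
    lemma (no ¬f) (yes u) _ _ _ U⇒F _ = contradiction (U⇒F u) ¬f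
    lemma (no ¬f) (no _) (yes d) _ _ _ D⇒F = contradiction (D⇒F d) ¬f
    lemma (no _) (no _) (no _) _ _ _ _ = z≤n
    lemma (yes _) (yes _) (yes _) (yes _) (yes _) _ _ = ≤-refl
    lemma (yes _) (yes _) (yes _) (yes _) (no _) _ _ = s≤s z≤n
    lemma (yes _) (yes _) (yes _) (no _) (yes _) _ _ = s≤s z≤n
    lemma (yes _) (yes _) (yes _) (no _) (no _) _ _ = z≤n
    lemma (yes _) (yes _) (no _) (yes _) _ _ _ = ≤-refl
    lemma (yes _) (yes _) (no _) (no _) _ _ _ = z≤n
    lemma (yes _) (no _) (yes _) _ (yes _) _ _ = s≤s z≤n
    lemma (yes _) (no _) (yes _) _ (no _) _ _ = z≤n
    lemma (yes _) (no _) (no _) _ _ _ _ = ≤-refl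

  -- The bound on `Up.Q?` absorbs the indicator of meeting D, and the bound on `Down.Q?` that of
  -- meeting U.
  chain-bound : ∀ {s r} → ↑.YFree s → ↓.YFree r → 2 ≤ s → 2 ≤ r → ∀ {C} → MaxChain C →
    # ↑.U°? C + 2 * ⟦ any? ↑.U? C ⟧ + (# ↓.U°? C + 2 * ⟦ any? ↓.U? C ⟧) + 2 * # R? C ≤ s + r + 2 * # M? C
  chain-bound {s} {r} yf yf′ 2≤s 2≤r {C} p = begin
      # ↑.U°? C + 2 * hU + (# ↓.U°? C + 2 * hD) + 2 * # R? C
        ≡⟨ solve 5 (λ a x b y ρ → a :+ x :+ (b :+ y) :+ ρ := (a :+ b :+ ρ) :+ (x :+ y)) refl
             (# ↑.U°? C) (2 * hU) (# ↓.U°? C) (2 * hD) (2 * # R? C) ⟩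
      (# ↑.U°? C + # ↓.U°? C + 2 * # R? C) + (2 * hU + 2 * hD)
        ≤⟨ +-monoˡ-≤ (2 * hU + 2 * hD) (#°-bound C) ⟩
      (2 * # M? C + # Up.Q? C + # Down.Q? C) + (2 * hU + 2 * hD)
        ≡⟨ solve 5 (λ m q q′ x y → (m :+ q :+ q′) :+ (x :+ y) := (q :+ y) :+ (q′ :+ x) :+ m) refl
             (2 * # M? C) (# Up.Q? C) (# Down.Q? C) (2 * hU) (2 * hD) ⟩
      (# Up.Q? C + 2 * hD) + (# Down.Q? C + 2 * hU) + 2 * # M? C
        ≤⟨ +-monoˡ-≤ (2 * # M? C) (+-mono-≤ (Up.#Q-bound yf 2≤s (path-sorted p)) down) ⟩
      s + r + 2 * # M? C ∎
    where
    open ≤-Reasoning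
    open +-*-Solver using (solve; _:+_; _:=_)
    hU = ⟦ any? ↑.U? C ⟧
    hD = ⟦ any? ↓.U? C ⟧
    -- For `⊃` the chain has to be listed from the top; the counts do not depend on the order.
    down : # Down.Q? C + 2 * hU ≤ r
    down = subst (_≤ r) (cong₂ (λ a b → a + 2 * b) (∑-↭ _ (↭-reverse C))
             (⟦⟧-cong (any? ↑.U? (reverse C)) (any? ↑.U? C) (Any-resp-↭ (↭-reverse C)) (Any-resp-↭ (↭-sym (↭-reverse C)))))
             (Down.#Q-bound yf′ 2≤r (AllPairs-reverse (path-sorted p)))

  LYM : ∀ {s r} → ↑.YFree s → ↓.YFree r → 2 ≤ s → 2 ≤ r → 2 * ∑ Fs weight ≤ (s + r) * n !
  LYM {s} {r} yf yf′ 2≤s 2≤r = ≤-trans (*-monoʳ-≤ 2 ∑-weight≤#F) (+-cancelʳ-≤ (2 * ∑ᶜ (# M?)) _ _ (begin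
      2 * ∑ᶜ #F + 2 * ∑ᶜ (# M?)
        ≡⟨ sym (*-distribˡ-+ 2 (∑ᶜ #F) _) ⟩
      2 * (∑ᶜ #F + ∑ᶜ (# M?))
        ≡⟨ cong (2 *_) (trans (sym (∑ᵖ-+ n ⊥ _ _)) (trans (∑ᵖ-cong n ⊥ λ {C} _ → #F+#M C)
             (trans (∑ᵖ-+ n ⊥ _ _) (cong (_+ ∑ᶜ (# R?)) (∑ᵖ-+ n ⊥ _ _))))) ⟩
      2 * (∑ᶜ (# ↑.U?) + ∑ᶜ (# ↓.U?) + ∑ᶜ (# R?))
        ≡⟨ trans (*-distribˡ-+ 2 (∑ᶜ (# ↑.U?) + ∑ᶜ (# ↓.U?)) _) (cong (_+ 2 * ∑ᶜ (# R?)) (*-distribˡ-+ 2 (∑ᶜ (# ↑.U?)) _)) ⟩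
      2 * ∑ᶜ (# ↑.U?) + 2 * ∑ᶜ (# ↓.U?) + 2 * ∑ᶜ (# R?)
        ≤⟨ +-monoˡ-≤ (2 * ∑ᶜ (# R?)) (+-mono-≤ ∑ᶜ-↑ ∑ᶜ-↓) ⟩
      ∑ᶜ (# ↑.U°?) + 2 * ∑ᶜ (λ C → ⟦ any? ↑.U? C ⟧) + (∑ᶜ (# ↓.U°?) + 2 * ∑ᶜ (λ C → ⟦ any? ↓.U? C ⟧)) + 2 * ∑ᶜ (# R?)
        ≡⟨ sym (trans (∑ᵖ-+ n ⊥ (λ C → # ↑.U°? C + 2 * ⟦ any? ↑.U? C ⟧ + (# ↓.U°? C + 2 * ⟦ any? ↓.U? C ⟧)) (λ C → 2 * # R? C))
             (cong₂ _+_ (trans (∑ᵖ-+ n ⊥ (λ C → # ↑.U°? C + 2 * ⟦ any? ↑.U? C ⟧) _)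
               (cong₂ _+_ (pull (# ↑.U°?) (λ C → ⟦ any? ↑.U? C ⟧)) (pull (# ↓.U°?) (λ C → ⟦ any? ↓.U? C ⟧))))
               (∑ᵖ-*ˡ n ⊥ 2 (# R?)))) ⟩
      ∑ᶜ (λ C → # ↑.U°? C + 2 * ⟦ any? ↑.U? C ⟧ + (# ↓.U°? C + 2 * ⟦ any? ↓.U? C ⟧) + 2 * # R? C)
        ≤⟨ ∑ᵖ-mono n ⊥ (chain-bound yf yf′ 2≤s 2≤r) ⟩
      ∑ᶜ (λ C → s + r + 2 * # M? C)
        ≡⟨ trans (pull (λ _ → s + r) (# M?)) (cong (_+ 2 * ∑ᶜ (# M?)) (trans (∑ᶜ-const {n} (s + r)) (*-comm (n !) (s + r)))) ⟩
      (s + r) * n ! + 2 * ∑ᶜ (# M?) ∎))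
    where
    open ≤-Reasoning
    pull : ∀ (g h : List (Subset n) → ℕ) → ∑ᶜ (λ C → g C + 2 * h C) ≡ ∑ᶜ g + 2 * ∑ᶜ h
    pull g h = trans (∑ᵖ-+ n ⊥ g _) (cong (∑ᶜ g +_) (∑ᵖ-*ˡ n ⊥ 2 h))

  LYM↑ : ↑.YFree 1 → ∑ Fs weight + ∑ Fs (λ A → ⟦ ¬? (↑.nonMax? A) ⟧ * weight A) ≤ 2 * n !
  LYM↑ = oneSided-LYM _⊂_ _⊂?_ ⊂-trans ∑ᶜ-↑

  LYM↓ : ↓.YFree 1 → ∑ Fs weight + ∑ Fs (λ A → ⟦ ¬? (↓.nonMax? A) ⟧ * weight A) ≤ 2 * n !
  LYM↓ = oneSided-LYM (flip _⊂_) (flip _⊂?_) (λ p q → ⊂-trans q p) ∑ᶜ-↓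

-- The largest binomial coefficients

insertDesc-↭ : ∀ x xs → insertDesc x xs ↭ x ∷ xs
insertDesc-↭ x [] = ↭-refl
insertDesc-↭ x (y ∷ ys) with y ≤? x
... | yes _ = ↭-refl
... | no _ = ↭-trans (prep y (insertDesc-↭ x ys)) (swap y x ↭-refl)

sortDesc-↭ : ∀ xs → sortDesc xs ↭ xs
sortDesc-↭ [] = ↭-refl
sortDesc-↭ (x ∷ xs) = ↭-trans (insertDesc-↭ x (sortDesc xs)) (prep x (sortDesc-↭ xs))

insertDesc-sorted : ∀ x {xs} → AllPairs _≥_ xs → AllPairs _≥_ (insertDesc x xs)
insertDesc-sorted x [] = [] ∷ []
insertDesc-sorted x {y ∷ ys} (ge ∷ ap) with y ≤? x
... | yes y≤x = (y≤x ∷ All.map (λ z≤y → ≤-trans z≤y y≤x) ge) ∷ ge ∷ ap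
... | no y≰x = All-resp-↭ (↭-sym (insertDesc-↭ x ys)) (<⇒≤ (≰⇒> y≰x) ∷ ge) ∷ insertDesc-sorted x ap

sortDesc-sorted : ∀ xs → AllPairs _≥_ (sortDesc xs)
sortDesc-sorted [] = []
sortDesc-sorted (x ∷ xs) = insertDesc-sorted x (sortDesc-sorted xs)

insertDesc-map : ∀ {X : Set} (f : X → ℕ) i is → ∃ λ js → js ↭ i ∷ is × insertDesc (f i) (map f is) ≡ map f js
insertDesc-map f i [] = i ∷ [] , ↭-refl , refl
insertDesc-map f i (j ∷ js) with f j ≤? f i
... | yes _ = i ∷ j ∷ js , ↭-refl , refl
... | no _ = let ks , p , eq = insertDesc-map f i js in
             j ∷ ks , ↭-trans (prep j p) (swap j i ↭-refl) , cong (f j ∷_) eq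

-- The indices are carried along with the sorted values, so that the largest coefficients can be
-- traced back to their levels.
sortDesc-map : ∀ {X : Set} (f : X → ℕ) is → ∃ λ js → js ↭ is × sortDesc (map f is) ≡ map f js
sortDesc-map f [] = [] , ↭-refl , refl
sortDesc-map f (i ∷ is) =
  let js , p , eq = sortDesc-map f is ; ks , q , eq′ = insertDesc-map f i js
  in ks , ↭-trans q (prep i p) , trans (cong (insertDesc (f i)) eq) eq′

-- The entry `t` at position `k`, counted from 0, works: truncated subtraction gives 0 from there
-- on, while each of the first `suc k` entries is `t` plus its excess over `t`.
kth-largest : ∀ k xs → AllPairs _≥_ xs → suc k ≤ length xs → ∃ λ t → t ∈ xs ×
  ∑ xs (_∸ t) + suc k * t ≡ sum (take (suc k) xs) × (∀ v → suc k ≤ ∑ xs (λ x → ⟦ v ≤? x ⟧) → v ≤ t)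
kth-largest zero (x ∷ xs) (ge ∷ _) _ = x , here refl , eq , largest
  where
  eq : x ∸ x + ∑ xs (_∸ x) + (x + 0) ≡ x + 0
  eq rewrite n∸n≡0 x | ∑-zero xs {_∸ x} (λ y∈ → m≤n⇒m∸n≡0 (All.lookup ge y∈)) = refl
  largest : ∀ v → 1 ≤ ⟦ v ≤? x ⟧ + ∑ xs (λ y → ⟦ v ≤? y ⟧) → v ≤ x
  largest v le = decidable-stable (v ≤? x) λ v≰x → contradiction
    (subst (1 ≤_) (∑-zero (x ∷ xs) λ {y} y∈ → ⟦⟧-no (v ≤? y) λ v≤y → v≰x (≤-trans v≤y (All.lookup (≤-refl ∷ ge) y∈))) le) λ ()
kth-largest (suc k) (x ∷ xs) (ge ∷ ap) (s≤s len) with kth-largest k xs ap len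
... | t , t∈ , eq , largest = t , there t∈ , eq′ , λ v le → largest v (s≤s⁻¹ (≤-trans le (+-monoˡ-≤ _ (⟦⟧≤1 (v ≤? x)))))
  where
  open ≡-Reasoning
  open +-*-Solver using (solve; _:+_; _:=_)
  eq′ : x ∸ t + ∑ xs (_∸ t) + (t + suc k * t) ≡ x + sum (take (suc k) xs)
  eq′ = begin
    x ∸ t + ∑ xs (_∸ t) + (t + suc k * t)   ≡⟨ solve 4 (λ a b c d → a :+ b :+ (c :+ d) := (a :+ c) :+ (b :+ d)) refl (x ∸ t) (∑ xs (_∸ t)) t (suc k * t) ⟩
    (x ∸ t + t) + (∑ xs (_∸ t) + suc k * t) ≡⟨ cong₂ _+_ (m∸n+n≡m (All.lookup ge t∈)) eq ⟩
    x + sum (take (suc k) xs) ∎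

∑-map : ∀ {X Y : Set} (xs : List X) (f : X → Y) g → ∑ (map f xs) g ≡ ∑ xs (g ∘ f)
∑-map xs f g = cong sum (sym (map-∘ xs))

-- Satisfied by the k-th largest binomial coefficient t of order n.
Threshold : ℕ → ℕ → ℕ → Set
Threshold n k t = ∑ (upTo (suc n)) (λ i → n choose i ∸ t) + k * t ≡ Sigma n k ×
  (∀ v I → Unique I → (∀ {i} → i ∈ I → i ≤ n × v ≤ n choose i) → k ≤ length I → v ≤ t)

threshold : ∀ n k → 1 ≤ k → k ≤ suc n → ∃ (Threshold n k)
threshold n (suc k) _ k≤n with kth-largest k (sortDesc bs) (sortDesc-sorted bs)
    (subst (suc k ≤_) (sym (trans (↭-length (sortDesc-↭ bs)) (trans (length-map (n choose_) (upTo (suc n))) (length-upTo (suc n))))) k≤n)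
  where bs = map (n choose_) (upTo (suc n))
... | t , _ , eq , largest = t , trans (cong (_+ suc k * t) (sym (over-upTo (_∸ t)))) eq , λ v I uI good len → largest v (begin
      suc k                                               ≤⟨ len ⟩
      length I                                            ≡⟨ sym (trans (∑-const I 1) (*-identityʳ _)) ⟩
      ∑ I (λ _ → 1)                                       ≡⟨ ∑-cong I (λ {i} i∈ → sym (⟦⟧-yes (v ≤? n choose i) (proj₂ (good i∈)))) ⟩
      ∑ I (λ i → ⟦ v ≤? n choose i ⟧)                          ≤⟨ ∑-⊆ _ uI (λ i∈ → ∈-upTo⁺ (s≤s (proj₁ (good i∈)))) ⟩
      ∑ (upTo (suc n)) (λ i → ⟦ v ≤? n choose i ⟧)             ≡⟨ sym (over-upTo (λ x → ⟦ v ≤? x ⟧)) ⟩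
      ∑ (sortDesc bs) (λ x → ⟦ v ≤? x ⟧)                  ∎)
  where
  open ≤-Reasoning
  bs = map (n choose_) (upTo (suc n))
  over-upTo : ∀ g → ∑ (sortDesc bs) g ≡ ∑ (upTo (suc n)) (g ∘ (n choose_))
  over-upTo g = trans (∑-↭ g (sortDesc-↭ bs)) (∑-map (upTo (suc n)) (n choose_) g)

-- Estimates for binomial coefficients and the threshold

C*!*! : ∀ {n k} → k ≤ n → n choose k * (k ! * (n ∸ k) !) ≡ n !
C*!*! {n} {k} k≤n = trans (cong (_* (k ! * (n ∸ k) !)) (nCk≡n!/k![n-k]! k≤n))
  (m/n*n≡m {{k !* (n ∸ k) !≢0}} (k![n∸k]!∣n! k≤n))

C-positive : ∀ {n k} → k ≤ n → 1 ≤ n choose k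
C-positive {n} {k} k≤n with n choose k | C*!*! k≤n
... | zero | eq = contradiction (sym eq) (≢-nonZero⁻¹ (n !) {{n !≢0}})
... | suc _ | _ = s≤s z≤n

C≥2 : ∀ {n k} → 1 ≤ k → k < n → 2 ≤ n choose k
C≥2 {suc n} {suc k} _ (s≤s k<n) = subst (2 ≤_) (nCk+nC[k+1]≡[n+1]C[k+1] n k)
  (+-mono-≤ (C-positive (<⇒≤ k<n)) (C-positive k<n))

C-step : ∀ {n k} → k < n → n choose suc k * suc k ≡ n choose k * (n ∸ k)
C-step {n} {k} k<n = *-cancelʳ-≡ _ _ (k ! * e !) {{k !* e !≢0}} (begin
    n choose suc k * suc k * (k ! * e !)    ≡⟨ solve 4 (λ a b c d → a :* b :* (c :* d) := a :* (b :* c :* d)) refl (n choose suc k) (suc k) (k !) (e !) ⟩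
    n choose suc k * (suc k ! * e !)        ≡⟨ C*!*! k<n ⟩
    n !                                ≡⟨ sym (C*!*! (<⇒≤ k<n)) ⟩
    n choose k * (k ! * (n ∸ k) !)          ≡⟨ cong (λ m → n choose k * (k ! * m !)) n∸k ⟩
    n choose k * (k ! * (suc e * e !))      ≡⟨ solve 4 (λ a b c d → a :* (b :* (c :* d)) := a :* c :* (b :* d)) refl (n choose k) (k !) (suc e) (e !) ⟩
    n choose k * suc e * (k ! * e !)        ≡⟨ cong (λ m → n choose k * m * (k ! * e !)) (sym n∸k) ⟩
    n choose k * (n ∸ k) * (k ! * e !)      ∎)
  where
  open ≡-Reasoning
  open +-*-Solver using (solve; _:*_; _:=_)
  e = n ∸ suc k
  n∸k : n ∸ k ≡ suc e
  n∸k = +-∸-assoc 1 k<n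

-- The index `j` is the neighbour of `i` on the side of the middle; `C-step` gives the ratio of the
-- two coefficients.
C-neighbour : ∀ {n i} → 3 ≤ n → i ≤ n → ∃ λ j → j ≢ i × j ≤ n × n choose i < 2 * n choose j
C-neighbour {n} {i} 3≤n i≤n = go i (n ∸ i) refl (m+[n∸m]≡n i≤n)
  where
  open ≤-Reasoning
  open +-*-Solver using (solve; _:*_; _:=_; con)

  e≥2 : ∀ i e → i ≤ e → 3 ≤ i + e → 2 ≤ e
  e≥2 zero e _ 3≤ = <⇒≤ 3≤
  e≥2 (suc i) (suc zero) (s≤s z≤n) (s≤s (s≤s ()))
  e≥2 (suc i) (suc (suc e)) _ _ = s≤s (s≤s z≤n)

  go : ∀ i e → n ∸ i ≡ e → i + e ≡ n → ∃ λ j → j ≢ i × j ≤ n × n choose i < 2 * n choose j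
  go i e n∸i i+e≡n with i ≤? e
  -- Upwards the ratio is `e / (i + 1)`, and `i + 1 ≤ e + 1 < 2 * e` because `n ≥ 3` forces `e ≥ 2`.
  ... | yes i≤e = suc i , (λ ()) , i<n , *-cancelʳ-< (suc i) (n choose i) _ (begin-strict
        n choose i * suc i           <⟨ *-monoʳ-< (n choose i) {{>-nonZero (C-positive (<⇒≤ i<n))}} small ⟩
        n choose i * (2 * e)         ≡⟨ solve 2 (λ a b → a :* (con 2 :* b) := con 2 :* (a :* b)) refl (n choose i) e ⟩
        2 * (n choose i * e)         ≡⟨ cong (λ m → 2 * (n choose i * m)) (sym n∸i) ⟩
        2 * (n choose i * (n ∸ i))   ≡⟨ cong (2 *_) (sym (C-step i<n)) ⟩
        2 * (n choose suc i * suc i) ≡⟨ sym (*-assoc 2 (n choose suc i) (suc i)) ⟩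
        2 * n choose suc i * suc i   ∎)
    where
    2≤e : 2 ≤ e
    2≤e = e≥2 i e i≤e (subst (3 ≤_) (sym i+e≡n) 3≤n)
    small : suc i < 2 * e
    small = begin-strict
      suc i   ≤⟨ s≤s i≤e ⟩
      suc e   <⟨ +-monoˡ-≤ e 2≤e ⟩
      e + e   ≡⟨ cong (e +_) (sym (+-identityʳ e)) ⟩
      2 * e   ∎
    i<n : i < n
    i<n = subst (i <_) i+e≡n (m<m+n i (<⇒≤ 2≤e))
  go zero e _ _ | no i≰e = contradiction z≤n i≰e
  -- Downwards the ratio is `(j + 1) / (e + 1)`, which is at least 1.
  go (suc j) e _ i+e≡n | no i≰e = j , (λ ()) , <⇒≤ j<n , *-cancelʳ-< (suc j) (n choose suc j) _ (begin-strict
        n choose suc j * suc j     ≡⟨ C-step j<n ⟩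
        n choose j * (n ∸ j)       ≡⟨ cong (λ m → n choose j * (m ∸ j)) (sym (trans (+-suc j e) i+e≡n)) ⟩
        n choose j * (j + suc e ∸ j) ≡⟨ cong (n choose j *_) (m+n∸m≡n j (suc e)) ⟩
        n choose j * suc e         <⟨ *-monoʳ-< (n choose j) {{>-nonZero (C-positive (<⇒≤ j<n))}} (≤-<-trans (≰⇒> i≰e) (m<m+n (suc j) (s≤s z≤n))) ⟩
        n choose j * (2 * suc j)   ≡⟨ solve 2 (λ a b → a :* (con 2 :* b) := con 2 :* a :* b) refl (n choose j) (suc j) ⟩
        2 * n choose j * suc j     ∎)
    where
    j<n : j < n
    j<n = subst (suc j ≤_) i+e≡n (m≤m+n (suc j) e)

threshold≥1 : ∀ {n k t} → Threshold n k t → k ≤ suc n → 1 ≤ t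
threshold≥1 {n} {k} (_ , big) k≤ = big 1 (upTo (suc n)) (upTo⁺ (suc n))
  (λ i∈ → let i≤n = s≤s⁻¹ (∈-upTo⁻ i∈) in i≤n , C-positive i≤n)
  (subst (k ≤_) (sym (length-upTo (suc n))) k≤)

-- The levels 1, ..., `n - 1` contain at least two sets each, and there are at least `k` of them.
threshold≥2 : ∀ {n k t} → Threshold n k t → k < n → 2 ≤ t
threshold≥2 {suc n} {k} (_ , big) (s≤s k≤n) = big 2 (applyUpTo suc n)
  (applyUpTo⁺₁ suc n λ i<j _ eq → <⇒≢ i<j (suc-injective eq)) inner
  (subst (k ≤_) (sym (length-applyUpTo suc n)) k≤n)
  where
  inner : ∀ {i} → i ∈ applyUpTo suc n → i ≤ suc n × 2 ≤ suc n choose i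
  inner i∈ with ∈-applyUpTo⁻ suc i∈
  ... | j , j<n , refl = s≤s (<⇒≤ j<n) , C≥2 (s≤s z≤n) (s≤s j<n)

-- The smaller of the coefficients at `i` and at its neighbour `j` is reached by two levels, hence
-- is at most `t`; the larger need not be, but `C-neighbour` compares the two.
C<2*threshold : ∀ {n t i} → Threshold n 2 t → 3 ≤ n → i ≤ n → n choose i < 2 * t
C<2*threshold {n} {t} {i} (_ , big) 3≤n i≤n with C-neighbour 3≤n i≤n
... | j , j≢i , j≤n , lt with ≤-total (n choose i) (n choose j)
...   | inj₁ le = <-≤-trans (m<m+n (n choose i) (≤-trans (C-positive i≤n) (≤-reflexive (sym (+-identityʳ _)))))
                   (*-monoʳ-≤ 2 (big (n choose i) (i ∷ j ∷ []) ((≢-sym j≢i ∷ []) ∷ [] ∷ [])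
                     (λ { (here refl) → i≤n , ≤-refl ; (there (here refl)) → j≤n , le }) ≤-refl))
...   | inj₂ ge = <-≤-trans lt (*-monoʳ-≤ 2 (big (n choose j) (i ∷ j ∷ []) ((≢-sym j≢i ∷ []) ∷ [] ∷ [])
                     (λ { (here refl) → i≤n , ge ; (there (here refl)) → j≤n , ≤-refl }) ≤-refl))

C*weight : ∀ {n} (A : Subset n) → n choose ∣ A ∣ * weight A ≡ n !
C*weight A = C*!*! (∣p∣≤n A)

module _ {n : ℕ} where

  open DecMembership (_≟ˢ_ {n}) using (_∈?_)

  -- n! = C(n,|A|) weight A ≤ (C(n,|A|) ∸ t) weight A + t weight A, and every maximal chain has one member of each size.
  size-bound : ∀ {Fs : List (Subset n)} → Unique Fs → ∀ t →
    length Fs * n ! ≤ ∑ (upTo (suc n)) (λ i → n choose i ∸ t) * n ! + t * ∑ Fs weight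
  size-bound {Fs} uniq t = begin
      length Fs * n !                                        ≡⟨ sym (∑-const Fs (n !)) ⟩
      ∑ Fs (λ _ → n !)                                       ≤⟨ ∑-mono Fs (λ {A} _ → element A) ⟩
      ∑ Fs (λ A → ψ A * weight A + t * weight A)             ≡⟨ trans (∑-+ Fs _ _) (cong (∑ Fs (λ A → ψ A * weight A) +_) (∑-*ˡ Fs t weight)) ⟩
      ∑ Fs (λ A → ψ A * weight A) + t * ∑ Fs weight          ≤⟨ +-monoˡ-≤ (t * ∑ Fs weight) total ⟩
      ∑ (upTo (suc n)) φ * n ! + t * ∑ Fs weight             ∎
    where
    open ≤-Reasoning
    φ : ℕ → ℕ
    φ i = n choose i ∸ t
    ψ : Subset n → ℕ
    ψ A = φ ∣ A ∣

    element : ∀ A → n ! ≤ ψ A * weight A + t * weight A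
    element A = begin
      n !                          ≡⟨ sym (C*weight A) ⟩
      n choose ∣ A ∣ * weight A          ≤⟨ *-monoˡ-≤ (weight A) (≤-trans (m≤n+m∸n (n choose ∣ A ∣) t) (≤-reflexive (+-comm t (ψ A)))) ⟩
      (ψ A + t) * weight A         ≡⟨ *-distribʳ-+ (weight A) (ψ A) t ⟩
      ψ A * weight A + t * weight A ∎

    total : ∑ Fs (λ A → ψ A * weight A) ≤ ∑ (upTo (suc n)) φ * n !
    total = begin
      ∑ Fs (λ A → ψ A * weight A)                            ≤⟨ ∑-mono Fs (λ {A} _ → *-monoʳ-≤ (ψ A) (weight≤∑ᶜ A)) ⟩
      ∑ Fs (λ A → ψ A * ∑ᶜ (λ C → ⟦ A ∈? C ⟧))               ≡⟨ ∑-cong Fs (λ {A} _ → sym (∑ᵖ-*ˡ n ⊥ (ψ A) _)) ⟩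
      ∑ Fs (λ A → ∑ᶜ (λ C → ψ A * ⟦ A ∈? C ⟧))               ≡⟨ sym (∑ᵖ-∑ n ⊥ Fs _) ⟩
      ∑ᶜ (λ C → ∑ Fs (λ A → ψ A * ⟦ A ∈? C ⟧))               ≤⟨ ∑ᵖ-mono n ⊥ chain ⟩
      ∑ᶜ {n} (λ _ → ∑ (upTo (suc n)) φ)                      ≡⟨ ∑ᶜ-const {n} _ ⟩
      n ! * ∑ (upTo (suc n)) φ                               ≡⟨ *-comm (n !) _ ⟩
      ∑ (upTo (suc n)) φ * n !                               ∎
      where
      chain : ∀ {C} → MaxChain C → ∑ Fs (λ A → ψ A * ⟦ A ∈? C ⟧) ≤ ∑ (upTo (suc n)) φ
      chain {C} p = begin
        ∑ Fs (λ A → ψ A * ⟦ A ∈? C ⟧)   ≡⟨ ∑-cong Fs (λ {A} _ → *-comm (ψ A) _) ⟩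
        ∑ Fs (λ A → ⟦ A ∈? C ⟧ * ψ A)   ≡⟨ ∑-∈-swap _≟ˢ_ ψ uniq (sorted⇒unique (path-sorted p)) ⟩
        ∑ C (λ A → ⟦ A ∈? Fs ⟧ * ψ A)   ≤⟨ ∑-mono C (λ {A} _ → ≤-trans (*-monoˡ-≤ (ψ A) (⟦⟧≤1 (A ∈? Fs))) (≤-reflexive (*-identityˡ (ψ A)))) ⟩
        ∑ C (φ ∘ ∣_∣)                   ≡⟨ sym (∑-map C ∣_∣ φ) ⟩
        ∑ (map ∣_∣ C) φ                 ≡⟨ cong (λ xs → ∑ xs φ) (maxChain-sizes p) ⟩
        ∑ (upTo (suc n)) φ              ∎

-- Copies of Y_k

module Embedding {n : ℕ} (_≺_ : Subset n → Subset n → Set) (≺-trans : Transitive _≺_) (≺-irrefl : ∀ {A} → ¬ A ≺ A)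
                 {y z : Subset n} (y⊀z : ¬ y ≺ z) (z⊀y : ¬ z ≺ y) (y≢z : y ≢ z) where

  -- Index `length xs` gives `y` and every larger index gives `z`. The bound `length xs + 2` in the
  -- lemmas below leaves just one index for `z`.
  nth : List (Subset n) → ℕ → Subset n
  nth [] zero = y
  nth [] (suc _) = z
  nth (x ∷ xs) zero = x
  nth (x ∷ xs) (suc i) = nth xs i

  All-nth : ∀ {P : Subset n → Set} {xs} → All P xs → P y → P z → ∀ i → P (nth xs i)
  All-nth [] py pz zero = py
  All-nth [] py pz (suc _) = pz
  All-nth (px ∷ _) py pz zero = px
  All-nth (_ ∷ ps) py pz (suc i) = All-nth ps py pz i

  nth-≺ : ∀ {xs} → AllPairs _≺_ xs → All (_≺ y) xs → All (_≺ z) xs →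
          ∀ {i j} → i < j → i < length xs → nth xs i ≺ nth xs j
  nth-≺ (lt ∷ _) (x≺y ∷ _) (x≺z ∷ _) {zero} {suc j} _ _ = All-nth lt x≺y x≺z j
  nth-≺ (_ ∷ ap) (_ ∷ ys) (_ ∷ zs) {suc i} {suc j} (s≤s i<j) (s≤s i<k) = nth-≺ ap ys zs i<j i<k

  nth-reflects : ∀ {xs} → AllPairs _≺_ xs → All (_≺ y) xs → All (_≺ z) xs → ∀ i j →
    i < length xs + 2 → j < length xs + 2 → nth xs i ≺ nth xs j → i < j × i < length xs
  nth-reflects [] _ _ zero zero _ _ lt = contradiction lt ≺-irrefl
  nth-reflects [] _ _ zero (suc _) _ _ lt = contradiction lt y⊀z
  nth-reflects [] _ _ (suc _) zero _ _ lt = contradiction lt z⊀y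
  nth-reflects [] _ _ (suc _) (suc _) _ _ lt = contradiction lt ≺-irrefl
  nth-reflects (_ ∷ _) _ _ zero zero _ _ lt = contradiction lt ≺-irrefl
  nth-reflects (_ ∷ _) _ _ zero (suc j) _ _ _ = s≤s z≤n , s≤s z≤n
  nth-reflects (lt ∷ _) (x≺y ∷ _) (x≺z ∷ _) (suc i) zero _ _ gt =
    contradiction (≺-trans (All-nth lt x≺y x≺z i) gt) ≺-irrefl
  nth-reflects (_ ∷ ap) (_ ∷ ys) (_ ∷ zs) (suc i) (suc j) (s≤s i<) (s≤s j<) lt =
    let i<j , i<k = nth-reflects ap ys zs i j i< j< lt in s≤s i<j , s≤s i<k

  nth-injective : ∀ {xs} → AllPairs _≺_ xs → All (_≺ y) xs → All (_≺ z) xs → ∀ i j →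
    i < length xs + 2 → j < length xs + 2 → nth xs i ≡ nth xs j → i ≡ j
  nth-injective [] _ _ zero zero _ _ _ = refl
  nth-injective [] _ _ zero (suc _) _ _ eq = contradiction eq y≢z
  nth-injective [] _ _ (suc _) zero _ _ eq = contradiction (sym eq) y≢z
  nth-injective [] _ _ (suc zero) (suc zero) _ _ _ = refl
  nth-injective [] _ _ (suc (suc _)) _ (s≤s (s≤s ())) _ _
  nth-injective [] _ _ _ (suc (suc _)) _ (s≤s (s≤s ())) _
  nth-injective (_ ∷ _) _ _ zero zero _ _ _ = refl
  nth-injective (lt ∷ _) (x≺y ∷ _) (x≺z ∷ _) zero (suc j) _ _ eq =
    contradiction (subst (_≺ _) eq (All-nth lt x≺y x≺z j)) ≺-irrefl
  nth-injective (lt ∷ _) (x≺y ∷ _) (x≺z ∷ _) (suc i) zero _ _ eq =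
    contradiction (subst (_≺ _) (sym eq) (All-nth lt x≺y x≺z i)) ≺-irrefl
  nth-injective (_ ∷ ap) (_ ∷ ys) (_ ∷ zs) (suc i) (suc j) (s≤s i<) (s≤s j<) eq =
    cong suc (nth-injective ap ys zs i j i< j< eq)

  embed : ∀ {Fs xs} → AllPairs _≺_ xs → All (_∈ Fs) xs → y ∈ Fs → z ∈ Fs → All (_≺ y) xs → All (_≺ z) xs →
    Σ (Fin (length xs + 2) → Subset n) λ α → (∀ {i j} → α i ≡ α j → i ≡ j) × (∀ i → α i ∈ Fs) ×
      (∀ i j → Yk (length xs) i j ⇔ (α i ≺ α j))
  embed {xs = xs} ap xs∈ y∈ z∈ ys zs = (λ i → nth xs (toℕ i)) ,
    (λ {i} {j} eq → toℕ-injective (nth-injective ap ys zs (toℕ i) (toℕ j) (toℕ<n i) (toℕ<n j) eq)) ,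
    (λ i → All-nth xs∈ y∈ z∈ (toℕ i)) ,
    λ i j → mk⇔ (λ (i<j , i<k) → nth-≺ ap ys zs i<j i<k) (nth-reflects ap ys zs (toℕ i) (toℕ j) (toℕ<n i) (toℕ<n j))

incomparable⇒≢ : ∀ {n} {A B : Subset n} → ¬ Comparable A B → A ≢ B
incomparable⇒≢ ¬cmp refl = ¬cmp (inj₁ ⊆-refl)

module _ {n : ℕ} {k : ℕ} (F : Family n) where

  Yk-free : ¬ ContainsInduced (Yk k) F → Direction.YFree _⊂_ _⊂?_ ⊂-trans (sets F) k
  Yk-free free {y = y} {z} ap xs∈ refl y∈ z∈ ys zs with comparable? y z
  ... | yes cmp = cmp
  ... | no ¬cmp = contradiction (embed ap xs∈ y∈ z∈ ys zs) free
    where open Embedding _⊂_ ⊂-trans (⊂-irref refl) {y} {z} (¬cmp ∘ inj₁ ∘ p⊂q⇒p⊆q) (¬cmp ∘ inj₂ ∘ p⊂q⇒p⊆q)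
                 (incomparable⇒≢ ¬cmp)

  Yk'-free : ¬ ContainsInduced (Yk' k) F → Direction.YFree (flip _⊂_) (flip _⊂?_) (λ p q → ⊂-trans q p) (sets F) k
  Yk'-free free {y = y} {z} ap xs∈ refl y∈ z∈ ys zs with comparable? y z
  ... | yes cmp = cmp
  -- Both `Yk'` and `⊃` reverse the order, hence the exchanged indices in `iff j i`.
  ... | no ¬cmp = contradiction (let α , inj , α∈ , iff = embed ap xs∈ y∈ z∈ ys zs in α , (λ {i} {j} → inj {i} {j}) , α∈ , λ i j → iff j i) free
    where open Embedding (flip _⊂_) (λ p q → ⊂-trans q p) (⊂-irref refl) {y} {z} (¬cmp ∘ inj₂ ∘ p⊂q⇒p⊆q) (¬cmp ∘ inj₁ ∘ p⊂q⇒p⊆q)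
                 (incomparable⇒≢ ¬cmp)

-- The union of the k largest levels

-- Split by the first element, so that the lengths follow Pascal's rule.
level : ∀ n → ℕ → List (Subset n)
level zero zero = [] ∷ []
level zero (suc _) = []
level (suc n) zero = map (outside ∷_) (level n zero)
level (suc n) (suc i) = map (outside ∷_) (level n (suc i)) ++ map (inside ∷_) (level n i)

∈-level⁻ : ∀ n i {A} → A ∈ level n i → ∣ A ∣ ≡ i
∈-level⁻ zero zero (here refl) = refl
∈-level⁻ (suc n) zero A∈ with ∈-map⁻ (outside ∷_) A∈
... | _ , B∈ , refl = ∈-level⁻ n zero B∈
∈-level⁻ (suc n) (suc i) A∈ with ∈-++⁻ (map (outside ∷_) (level n (suc i))) A∈
... | inj₁ A∈₁ with ∈-map⁻ (outside ∷_) A∈₁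
...   | _ , B∈ , refl = ∈-level⁻ n (suc i) B∈
∈-level⁻ (suc n) (suc i) A∈ | inj₂ A∈₂ with ∈-map⁻ (inside ∷_) A∈₂
...   | _ , B∈ , refl = cong suc (∈-level⁻ n i B∈)

level-unique : ∀ n i → Unique (level n i)
level-unique zero zero = [] ∷ []
level-unique zero (suc i) = []
level-unique (suc n) zero = Uniqueₚ.map⁺ ∷-injectiveʳ (level-unique n zero)
level-unique (suc n) (suc i) = Uniqueₚ.++⁺ (Uniqueₚ.map⁺ ∷-injectiveʳ (level-unique n (suc i)))
  (Uniqueₚ.map⁺ ∷-injectiveʳ (level-unique n i))
  λ (A∈ , A∈′) → let _ , _ , eq = ∈-map⁻ (outside ∷_) A∈ ; _ , _ , eq′ = ∈-map⁻ (inside ∷_) A∈′ in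
    contradiction (∷-injectiveˡ (trans (sym eq) eq′)) λ ()

length-level : ∀ n i → length (level n i) ≡ n choose i
length-level zero zero = refl
length-level zero (suc i) = refl
length-level (suc n) zero = trans (length-map (outside ∷_) (level n zero)) (length-level n zero)
length-level (suc n) (suc i) = begin
    length (level (suc n) (suc i))
      ≡⟨ length-++ (map (outside ∷_) (level n (suc i))) ⟩
    length (map (outside ∷_) (level n (suc i))) + length (map (inside ∷_) (level n i))
      ≡⟨ cong₂ _+_ (length-map _ (level n (suc i))) (length-map _ (level n i)) ⟩
    length (level n (suc i)) + length (level n i)
      ≡⟨ cong₂ _+_ (length-level n (suc i)) (length-level n i) ⟩
    n choose suc i + n choose i
      ≡⟨ +-comm (n choose suc i) _ ⟩
    n choose i + n choose suc i
      ≡⟨ nCk+nC[k+1]≡[n+1]C[k+1] n i ⟩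
    suc n choose suc i ∎
  where open ≡-Reasoning

length-concatMap : ∀ {X Y : Set} (f : X → List Y) xs → length (concatMap f xs) ≡ ∑ xs (length ∘ f)
length-concatMap f [] = refl
length-concatMap f (x ∷ xs) = trans (length-++ (f x)) (cong (length (f x) +_) (length-concatMap f xs))

∈-concatMap-level⁻ : ∀ {n} I {A} → A ∈ concatMap (level n) I → ∣ A ∣ ∈ I
∈-concatMap-level⁻ {n} (i ∷ I) A∈ with ∈-++⁻ (level n i) A∈
... | inj₁ A∈i = here (∈-level⁻ n i A∈i)
... | inj₂ A∈I = there (∈-concatMap-level⁻ I A∈I)

levels : ∀ {n} I → Unique I → Family n
levels {n} I uI = family (concatMap (level n) I) (Uniqueₚ.concat⁺
  (Allₚ.map⁺ (All.tabulate λ {i} _ → level-unique n i))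
  (APₚ.map⁺ (AllPairs.map disjoint uI)))
  where
  disjoint : ∀ {i j} → i ≢ j → Disjoint (level n i) (level n j)
  disjoint {i} {j} i≢j (A∈i , A∈j) = i≢j (trans (sym (∈-level⁻ n i A∈i)) (∈-level⁻ n j A∈j))

-- Pigeonhole on the positions of the values in `I`.
repeated-size : ∀ {k} {I : List ℕ} (g : Fin (suc k) → ℕ) → (∀ i → g i ∈ I) → length I ≤ k →
  ∃₂ λ i j → toℕ i < toℕ j × g i ≡ g j
repeated-size {I = I} g g∈ len with pigeonhole (s≤s len) (index ∘ g∈)
... | i , j , i<j , eq = i , j , i<j ,
  trans (lookup-index (g∈ i)) (trans (cong (List.lookup I) eq) (sym (lookup-index (g∈ j))))

module _ {n k : ℕ} (I : List ℕ) (uI : Unique I) (len : length I ≤ k) where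

  private
    -- The points x_1, ..., x_k, y_1 of `Y_k`. They form a chain of `k + 1` elements, whose images
    -- would need `k + 1` different sizes.
    ι : Fin (suc k) → Fin (k + 2)
    ι i = fromℕ< (<-≤-trans (toℕ<n i) (≤-trans (n≤1+n (suc k)) (≤-reflexive (+-comm 2 k))))

    ι< : ∀ {i j} → toℕ i < toℕ j → Yk k (ι i) (ι j)
    ι< {i} {j} i<j = subst₂ _<_ (sym (toℕ-fromℕ< _)) (sym (toℕ-fromℕ< _)) i<j ,
      subst (_< k) (sym (toℕ-fromℕ< _)) (<-≤-trans i<j (s≤s⁻¹ (toℕ<n j)))

  levels-Yk-free : ¬ ContainsInduced (Yk k) (levels {n} I uI)
  levels-Yk-free (α , _ , α∈ , iff) =
    let i , j , i<j , eq = repeated-size (∣_∣ ∘ α ∘ ι) (∈-concatMap-level⁻ I ∘ α∈ ∘ ι) len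
    in <⇒≢ (p⊂q⇒∣p∣<∣q∣ (Equivalence.to (iff (ι i) (ι j)) (ι< i<j))) eq

  levels-Yk'-free : ¬ ContainsInduced (Yk' k) (levels {n} I uI)
  levels-Yk'-free (α , _ , α∈ , iff) =
    let i , j , i<j , eq = repeated-size (∣_∣ ∘ α ∘ ι) (∈-concatMap-level⁻ I ∘ α∈ ∘ ι) len
    in <⇒≢ (p⊂q⇒∣p∣<∣q∣ (Equivalence.to (iff (ι j) (ι i)) (ι< i<j))) (sym eq)

lower-bound : ∀ k n → Σ (Family n) λ F →
  ¬ ContainsInduced (Yk k) F × ¬ ContainsInduced (Yk' k) F × size F ≡ Sigma n k
lower-bound k n with sortDesc-map (n choose_) (upTo (suc n))
... | js , js↭ , eq = levels I uI , levels-Yk-free I uI len , levels-Yk'-free I uI len , (begin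
    length (concatMap (level n) I)                    ≡⟨ length-concatMap (level n) I ⟩
    ∑ I (length ∘ level n)                            ≡⟨ ∑-cong I (λ {i} _ → length-level n i) ⟩
    sum (map (n choose_) (take k js))                 ≡⟨ cong sum (sym (take-map k js)) ⟩
    sum (take k (map (n choose_) js))                 ≡⟨ cong (sum ∘ take k) (sym eq) ⟩
    Sigma n k                                         ∎)
  where
  open ≡-Reasoning
  I = take k js
  uI : Unique I
  uI = Uniqueₚ.take⁺ k (Unique-resp-↭ (setoid ℕ) (↭⇒↭ₛ (↭-sym js↭)) (upTo⁺ (suc n)))
  len : length I ≤ k
  len = ≤-trans (≤-reflexive (length-take k js)) (m⊓n≤m k (length js))

-- The upper bound

-- One pass through the list is enough: by transitivity, an entry that is not above the current
-- element is not above any later one either.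
climb : ∀ {X : Set} {_≺_ : X → X → Set} → Decidable₂ _≺_ → Transitive _≺_ → (∀ {x} → ¬ x ≺ x) → ∀ x ys →
  ∃ λ m → (m ≡ x ⊎ x ≺ m) × m ∈ x ∷ ys × ¬ Any (m ≺_) ys
climb _≺?_ ≺-trans irr x [] = x , inj₁ refl , here refl , λ ()
climb {_≺_ = _≺_} _≺?_ ≺-trans irr x (y ∷ ys) with x ≺? y
... | yes x≺y with climb _≺?_ ≺-trans irr y ys
...   | m , y≼m , m∈ , max = m , inj₂ (x≺m y≼m) , there m∈ , λ { (here m≺y) → m⊀y y≼m m≺y ; (there m≺) → max m≺ }
  where
  x≺m : m ≡ y ⊎ y ≺ m → x ≺ m
  x≺m (inj₁ refl) = x≺y
  x≺m (inj₂ y≺m) = ≺-trans x≺y y≺m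
  m⊀y : m ≡ y ⊎ y ≺ m → ¬ m ≺ y
  m⊀y (inj₁ refl) = irr
  m⊀y (inj₂ y≺m) m≺y = irr (≺-trans y≺m m≺y)
climb {_≺_ = _≺_} _≺?_ ≺-trans irr x (y ∷ ys) | no x⊀y with climb _≺?_ ≺-trans irr x ys
... | m , x≼m , m∈ , max = m , x≼m , skip m∈ , λ { (here m≺y) → x⊀y (x≺y x≼m m≺y) ; (there m≺) → max m≺ }
  where
  skip : m ∈ x ∷ ys → m ∈ x ∷ y ∷ ys
  skip (here eq) = here eq
  skip (there m∈) = there (there m∈)
  x≺y : m ≡ x ⊎ x ≺ m → m ≺ y → x ≺ y
  x≺y (inj₁ refl) m≺y = m≺y
  x≺y (inj₂ x≺m) m≺y = ≺-trans x≺m m≺y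

Unique-map : ∀ {X Y : Set} (f : X → Y) {xs} → Unique xs → (∀ {x y} → x ∈ xs → y ∈ xs → f x ≡ f y → x ≡ y) →
  Unique (map f xs)
Unique-map f [] _ = []
Unique-map f {x ∷ xs} (x≢ ∷ uq) inj =
  All.tabulate (λ fy∈ fx≡ → let y , y∈ , eq = ∈-map⁻ f fy∈ in
    All.lookup x≢ y∈ (inj (here refl) (there y∈) (trans fx≡ eq))) ∷
  Unique-map f uq λ y∈ z∈ → inj (there y∈) (there z∈)

-- Comparable sets of equal size coincide, so the sizes are distinct numbers up to `n`.
chain-size : ∀ {n} {Gs : List (Subset n)} → Unique Gs → (∀ {A B} → A ∈ Gs → B ∈ Gs → Comparable A B) → length Gs ≤ suc n
chain-size {n} {Gs} uq cmp = begin
    length Gs                     ≡⟨ sym (trans (∑-const Gs 1) (*-identityʳ _)) ⟩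
    ∑ Gs (λ _ → 1)                ≡⟨ sym (∑-map Gs ∣_∣ _) ⟩
    ∑ (map ∣_∣ Gs) (λ _ → 1)      ≤⟨ ∑-⊆ _ (Unique-map ∣_∣ uq same) (λ i∈ → let A , _ , eq = ∈-map⁻ ∣_∣ i∈ in
                                       ∈-upTo⁺ (s≤s (subst (_≤ n) (sym eq) (∣p∣≤n A)))) ⟩
    ∑ (upTo (suc n)) (λ _ → 1)    ≡⟨ trans (∑-const (upTo (suc n)) 1) (trans (*-identityʳ _) (length-upTo (suc n))) ⟩
    suc n                         ∎
  where
  open ≤-Reasoning
  same : ∀ {A B} → A ∈ Gs → B ∈ Gs → ∣ A ∣ ≡ ∣ B ∣ → A ≡ B
  same A∈ B∈ eq with cmp A∈ B∈
  ... | inj₁ A⊆B = ⊆∧∣≡∣⇒≡ A⊆B eq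
  ... | inj₂ B⊆A = sym (⊆∧∣≡∣⇒≡ B⊆A (sym eq))

weight≥1 : ∀ {n} (A : Subset n) → 1 ≤ weight A
weight≥1 {n} A = *-mono-≤ (1≤n! ∣ A ∣) (1≤n! (n ∸ ∣ A ∣))

-- Removing the empty and the full set, and paying for them

module UpperBound {n : ℕ} (Gs : List (Subset n)) (uniq-Gs : Unique Gs) where

  open DecMembership (_≟ˢ_ {n}) using (_∈?_)

  Proper : Subset n → Set
  Proper A = A ≢ ⊥ × A ≢ ⊤

  proper? : Decidable Proper
  proper? A = ¬? (A ≟ˢ ⊥) ×-dec ¬? (A ≟ˢ ⊤)

  Fs : List (Subset n)
  Fs = filter proper? Gs

  Fs⊆Gs : ∀ {A} → A ∈ Fs → A ∈ Gs
  Fs⊆Gs A∈ = proj₁ (∈-filter⁻ proper? A∈)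

  proper : ∀ {A} → A ∈ Fs → Proper A
  proper A∈ = proj₂ (∈-filter⁻ proper? {xs = Gs} A∈)

  uniq : Unique Fs
  uniq = Uniqueₚ.filter⁺ proper? uniq-Gs

  module G↑ = Direction _⊂_ _⊂?_ ⊂-trans Gs
  module G↓ = Direction (flip _⊂_) (flip _⊂?_) (λ p q → ⊂-trans q p) Gs
  open TwoSided Fs uniq (λ ⊥∈ → proj₁ (proper ⊥∈) refl) (λ ⊤∈ → proj₂ (proper ⊤∈) refl)

  length≤ : length Gs ≤ length Fs + (⟦ ⊥ ∈? Gs ⟧ + ⟦ ⊤ ∈? Gs ⟧)
  length≤ = begin
      length Gs                                                    ≡⟨ sym (trans (∑-const Gs 1) (*-identityʳ _)) ⟩
      ∑ Gs (λ _ → 1)                                               ≤⟨ ∑-mono Gs (λ {A} _ → cover (A ≟ˢ ⊥) (A ≟ˢ ⊤)) ⟩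
      ∑ Gs (λ A → ⟦ proper? A ⟧ + (⟦ A ≟ˢ ⊥ ⟧ * 1 + ⟦ A ≟ˢ ⊤ ⟧ * 1)) ≡⟨ trans (∑-+ Gs _ _) (cong₂ _+_ count
                                                                        (trans (∑-+ Gs _ _) (cong₂ _+_ (single ⊥) (single ⊤)))) ⟩
      length Fs + (⟦ ⊥ ∈? Gs ⟧ + ⟦ ⊤ ∈? Gs ⟧)                       ∎
    where
    open ≤-Reasoning
    cover : ∀ {P Q : Set} (p : Dec P) (q : Dec Q) → 1 ≤ ⟦ ¬? p ×-dec ¬? q ⟧ + (⟦ p ⟧ * 1 + ⟦ q ⟧ * 1)
    cover (yes _) _ = s≤s z≤n
    cover (no _) (yes _) = s≤s z≤n
    cover (no _) (no _) = s≤s z≤n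
    count : # proper? Gs ≡ length Fs
    count = trans (#-filter proper? proper? id Gs) (trans
      (∑-cong Fs λ {A} A∈ → ⟦⟧-yes (proper? A) (proper A∈)) (trans (∑-const Fs 1) (*-identityʳ _)))
    single : ∀ B → ∑ Gs (λ A → ⟦ A ≟ˢ B ⟧ * 1) ≡ ⟦ B ∈? Gs ⟧
    single B = trans (∑-δ _≟ˢ_ (λ _ → 1) B uniq-Gs) (*-identityʳ _)

  ⊥⊂ : ∀ {A} → A ∈ Fs → ⊥ ⊂ A
  ⊥⊂ A∈ = ⊥⊆ , let u , u∈ = ≢⊥⇒∃∈ (proj₁ (proper A∈)) in u , u∈ , ∉⊥

  ⊂⊤ : ∀ {A} → A ∈ Fs → A ⊂ ⊤
  ⊂⊤ A∈ = ⊆⊤ , let v , v∉ = ≢⊤⇒∃∉ (proj₂ (proper A∈)) in v , ∈⊤ , v∉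

  free↑ : ∀ {k} → G↑.YFree k → ↑.YFree k
  free↑ free ap xs∈ len y∈ z∈ = free ap (All.map Fs⊆Gs xs∈) len (Fs⊆Gs y∈) (Fs⊆Gs z∈)

  free↓ : ∀ {k} → G↓.YFree k → ↓.YFree k
  free↓ free ap xs∈ len y∈ z∈ = free ap (All.map Fs⊆Gs xs∈) len (Fs⊆Gs y∈) (Fs⊆Gs z∈)

  -- Putting `⊥` below a chain of `k` members of `Fs` gives a chain of `k + 1` members of `Gs`.
  free↑-pred : ∀ {k} → ⊥ ∈ Gs → G↑.YFree (suc k) → ↑.YFree k
  free↑-pred ⊥∈ free ap xs∈ len y∈ z∈ ys zs = free (All.map ⊥⊂ xs∈ ∷ ap) (⊥∈ ∷ All.map Fs⊆Gs xs∈) (cong suc len)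
    (Fs⊆Gs y∈) (Fs⊆Gs z∈) (⊥⊂ y∈ ∷ ys) (⊥⊂ z∈ ∷ zs)

  free↓-pred : ∀ {k} → ⊤ ∈ Gs → G↓.YFree (suc k) → ↓.YFree k
  free↓-pred ⊤∈ free ap xs∈ len y∈ z∈ ys zs = free (All.map ⊂⊤ xs∈ ∷ ap) (⊤∈ ∷ All.map Fs⊆Gs xs∈) (cong suc len)
    (Fs⊆Gs y∈) (Fs⊆Gs z∈) (⊂⊤ y∈ ∷ ys) (⊂⊤ z∈ ∷ zs)

  W : ℕ
  W = ∑ Fs weight

  -- The number `d` is the amount by which the LYM constant `m` falls short of `2 * k`. By
  -- `size-bound`, each unit of it saves `t` on the left, which pays for `⊥` and `⊤`.
  twoSided-size : ∀ {k t m d} → Threshold n k t → 2 * W ≤ m * n ! → m + d ≡ 2 * k → 2 * length Fs + t * d ≤ 2 * Sigma n k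
  twoSided-size {k} {t} {m} {d} (eq , _) 2W≤ m+d = *-cancelʳ-≤ _ _ (n !) {{n !≢0}} (begin
      (2 * length Fs + t * d) * n !               ≡⟨ solve 4 (λ l t d f → (con 2 :* l :+ t :* d) :* f := con 2 :* (l :* f) :+ t :* d :* f) refl (length Fs) t d (n !) ⟩
      2 * (length Fs * n !) + t * d * n !         ≤⟨ +-monoˡ-≤ (t * d * n !) (*-monoʳ-≤ 2 (size-bound uniq t)) ⟩
      2 * (S * n ! + t * W) + t * d * n !         ≡⟨ solve 5 (λ s f t w d → con 2 :* (s :* f :+ t :* w) :+ t :* d :* f := con 2 :* (s :* f) :+ t :* d :* f :+ t :* (con 2 :* w)) refl S (n !) t W d ⟩
      2 * (S * n !) + t * d * n ! + t * (2 * W)   ≤⟨ +-monoʳ-≤ (2 * (S * n !) + t * d * n !) (*-monoʳ-≤ t 2W≤) ⟩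
      2 * (S * n !) + t * d * n ! + t * (m * n !) ≡⟨ solve 5 (λ s f t m d → con 2 :* (s :* f) :+ t :* d :* f :+ t :* (m :* f) := (con 2 :* s :+ t :* (m :+ d)) :* f) refl S (n !) t m d ⟩
      (2 * S + t * (m + d)) * n !                 ≡⟨ cong (λ x → (2 * S + t * x) * n !) m+d ⟩
      (2 * S + t * (2 * k)) * n !                 ≡⟨ solve 4 (λ s t k f → (con 2 :* s :+ t :* (con 2 :* k)) :* f := (con 2 :* (s :+ k :* t)) :* f) refl S t k (n !) ⟩
      (2 * (S + k * t)) * n !                     ≡⟨ cong (λ x → (2 * x) * n !) eq ⟩
      2 * Sigma n k * n !                         ∎)
    where
    open ≤-Reasoning
    open +-*-Solver using (solve; _:*_; _:+_; _:=_; con)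
    S = ∑ (upTo (suc n)) (λ i → n choose i ∸ t)

  oneSided-size : ∀ {t V} → Threshold n 2 t → W + V ≤ 2 * n ! → length Fs * n ! + t * V ≤ Sigma n 2 * n !
  oneSided-size {t} {V} (eq , _) W+V≤ = begin
      length Fs * n ! + t * V       ≤⟨ +-monoˡ-≤ (t * V) (size-bound uniq t) ⟩
      S * n ! + t * W + t * V       ≡⟨ solve 5 (λ s f t w v → s :* f :+ t :* w :+ t :* v := s :* f :+ t :* (w :+ v)) refl S (n !) t W V ⟩
      S * n ! + t * (W + V)         ≤⟨ +-monoʳ-≤ (S * n !) (*-monoʳ-≤ t W+V≤) ⟩
      S * n ! + t * (2 * n !)       ≡⟨ solve 3 (λ s f t → s :* f :+ t :* (con 2 :* f) := (s :+ con 2 :* t) :* f) refl S (n !) t ⟩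
      (S + 2 * t) * n !             ≡⟨ cong (_* n !) eq ⟩
      Sigma n 2 * n !               ∎
    where
    open ≤-Reasoning
    open +-*-Solver using (solve; _:*_; _:+_; _:=_; con)
    S = ∑ (upTo (suc n)) (λ i → n choose i ∸ t)

  2*threshold≤Sigma : ∀ {t} → Threshold n 2 t → 2 * t ≤ Sigma n 2
  2*threshold≤Sigma {t} (eq , _) = ≤-trans (m≤n+m (2 * t) (∑ (upTo (suc n)) (λ i → n choose i ∸ t))) (≤-reflexive eq)

  -- A single member satisfying `M`, to be read as maximal or minimal, makes `V` positive and the
  -- inequality of `oneSided-size` strict. An empty `Fs` is covered by `Sigma n 2 ≥ 2 * t > 0`.
  oneSided-strict : ∀ {t} {M : Subset n → Set} (M? : Decidable M) → Threshold n 2 t → 1 ≤ n →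
    W + ∑ Fs (λ A → ⟦ M? A ⟧ * weight A) ≤ 2 * n ! → (∀ {A} → A ∈ Fs → ∃ λ B → B ∈ Fs × M B) → length Fs < Sigma n 2
  oneSided-strict {t} M? thr 1≤n bound maximal = go (any? (λ _ → yes tt) Fs)
    where
    open ≤-Reasoning
    t≥1 : 1 ≤ t
    t≥1 = threshold≥1 thr (s≤s 1≤n)
    V = ∑ Fs (λ A → ⟦ M? A ⟧ * weight A)
    go : Dec (Any (λ _ → Unit) Fs) → length Fs < Sigma n 2
    go (no empty) = ≤-trans (s≤s (≤-reflexive none)) (≤-trans t≥1 (≤-trans (m≤m+n t (t + 0)) (2*threshold≤Sigma thr)))
      where
      none : length Fs ≡ 0
      none = trans (sym (trans (∑-const Fs 1) (*-identityʳ _))) (∑-zero Fs λ A∈ → contradiction (lose A∈ tt) empty)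
    go (yes ne) = *-cancelʳ-< (n !) (length Fs) (Sigma n 2) (begin-strict
        length Fs * n !           <⟨ m<m+n (length Fs * n !) (*-mono-≤ t≥1 V≥1) ⟩
        length Fs * n ! + t * V   ≤⟨ oneSided-size thr bound ⟩
        Sigma n 2 * n !           ∎)
      where
      V≥1 : 1 ≤ V
      V≥1 = let A , A∈ , _ = find ne ; B , B∈ , MB = maximal A∈ in begin
        1                       ≤⟨ weight≥1 B ⟩
        weight B                ≡⟨ sym (*-identityˡ (weight B)) ⟩
        1 * weight B            ≡⟨ cong (_* weight B) (sym (⟦⟧-yes (M? B) MB)) ⟩
        ⟦ M? B ⟧ * weight B     ≤⟨ member≤∑ _ B∈ ⟩
        V                       ∎

  climb↑ : ∀ {A} → A ∈ Fs → ∃ λ B → (B ≡ A ⊎ A ⊂ B) × B ∈ Fs × ¬ ↑.NonMax B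
  climb↑ {A} A∈ with climb _⊂?_ ⊂-trans (⊂-irref refl) A Fs
  ... | B , A≼B , here refl , max = B , A≼B , A∈ , max
  ... | B , A≼B , there B∈ , max = B , A≼B , B∈ , max

  climb↓ : ∀ {A} → A ∈ Fs → ∃ λ B → (B ≡ A ⊎ B ⊂ A) × B ∈ Fs × ¬ ↓.NonMax B
  climb↓ {A} A∈ with climb (flip _⊂?_) (λ p q → ⊂-trans q p) (⊂-irref refl) A Fs
  ... | B , A≼B , here refl , max = B , A≼B , A∈ , max
  ... | B , A≼B , there B∈ , max = B , A≼B , B∈ , max

  incomparable⇒∈Fs : ∀ {A B} → A ∈ Gs → ¬ Comparable A B → A ∈ Fs
  incomparable⇒∈Fs A∈ ¬cmp = ∈-filter⁺ proper? A∈ ((λ { refl → ¬cmp (inj₁ ⊥⊆) }) , λ { refl → ¬cmp (inj₂ ⊆⊤) })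

  -- Two incomparable members lie below different maximal members of Fs, whose weights account for ⊥ and ⊤.
  incomparable-size : ∀ {t A B} → Threshold n 2 t → 3 ≤ n → ↑.YFree 1 → ↓.YFree 1 →
    A ∈ Fs → B ∈ Fs → ¬ Comparable A B → length Fs + 2 ≤ Sigma n 2
  incomparable-size {t} {A} {B} thr 3≤n yf yf′ A∈ B∈ ¬cmp with climb↑ A∈ | climb↑ B∈
  ... | A′ , A≼A′ , A′∈ , maxA | B′ , B≼B′ , B′∈ , maxB = begin
      length Fs + 2   ≡⟨ +-comm (length Fs) 2 ⟩
      2 + length Fs   ≤⟨ *-cancelʳ-< (n !) (suc (length Fs)) (Sigma n 2) (begin-strict
          suc (length Fs) * n !     ≡⟨ +-comm (n !) _ ⟩
          length Fs * n ! + n !     <⟨ +-monoʳ-< (length Fs * n !) n!<tV ⟩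
          length Fs * n ! + t * V   ≤⟨ oneSided-size thr (LYM↑ yf) ⟩
          Sigma n 2 * n !           ∎) ⟩
      Sigma n 2       ∎
    where
    open ≤-Reasoning
    max? : Decidable (λ X → ¬ ↑.NonMax X)
    max? X = ¬? (↑.nonMax? X)
    V = ∑ Fs (λ X → ⟦ max? X ⟧ * weight X)

    -- If `A′` and `B′` were equal and above both `A` and `B`, then `↓.YFree 1` would make `A` and
    -- `B` comparable.
    A′≢B′ : A′ ≢ B′
    A′≢B′ refl = conflict A≼A′ B≼B′
      where
      conflict : A′ ≡ A ⊎ A ⊂ A′ → ¬ (A′ ≡ B ⊎ B ⊂ A′)
      conflict (inj₁ refl) (inj₁ refl) = ¬cmp (inj₁ ⊆-refl)
      conflict (inj₁ refl) (inj₂ B⊂) = ¬cmp (inj₂ (p⊂q⇒p⊆q B⊂))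
      conflict (inj₂ A⊂) (inj₁ refl) = ¬cmp (inj₁ (p⊂q⇒p⊆q A⊂))
      conflict (inj₂ A⊂) (inj₂ B⊂) = ¬cmp (yf′ ([] ∷ []) (A′∈ ∷ []) refl A∈ B∈ (A⊂ ∷ []) (B⊂ ∷ []))

    -- The quotient of `n !` by the weight of `X` is a binomial coefficient, hence less than
    -- `2 * t`. Two such weights bring `t * V` above `n !`.
    heavy : ∀ X → n ! < 2 * t * weight X
    heavy X = begin-strict
      n !                           ≡⟨ sym (C*weight X) ⟩
      n choose ∣ X ∣ * weight X      <⟨ *-monoˡ-< (weight X) {{>-nonZero (weight≥1 X)}} (C<2*threshold thr 3≤n (∣p∣≤n X)) ⟩
      2 * t * weight X              ∎

    V≥ : weight A′ + weight B′ ≤ V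
    V≥ = begin
      weight A′ + weight B′                                ≡⟨ cong (weight A′ +_) (sym (+-identityʳ (weight B′))) ⟩
      ∑ (A′ ∷ B′ ∷ []) weight                              ≡⟨ ∑-cong (A′ ∷ B′ ∷ []) (λ {X} X∈ → sym (trans
                                                                (cong (_* weight X) (⟦⟧-yes (max? X) (max X∈))) (*-identityˡ (weight X)))) ⟩
      ∑ (A′ ∷ B′ ∷ []) (λ X → ⟦ max? X ⟧ * weight X)       ≤⟨ ∑-⊆ _ ((A′≢B′ ∷ []) ∷ [] ∷ [])
                                                                (λ { (here refl) → A′∈ ; (there (here refl)) → B′∈ }) ⟩
      V                                                    ∎
      where
      max : ∀ {X} → X ∈ A′ ∷ B′ ∷ [] → ¬ ↑.NonMax X
      max (here refl) = maxA
      max (there (here refl)) = maxB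

    n!<tV : n ! < t * V
    n!<tV = *-cancelˡ-< 2 (n !) (t * V) (begin-strict
      2 * n !                                    ≡⟨ cong (n ! +_) (+-identityʳ (n !)) ⟩
      n ! + n !                                  <⟨ +-mono-< (heavy A′) (heavy B′) ⟩
      2 * t * weight A′ + 2 * t * weight B′      ≡⟨ sym (*-distribˡ-+ (2 * t) (weight A′) (weight B′)) ⟩
      2 * t * (weight A′ + weight B′)            ≤⟨ *-monoʳ-≤ (2 * t) V≥ ⟩
      2 * t * V                                  ≡⟨ *-assoc 2 t V ⟩
      2 * (t * V)                                ∎)

  conclude : ∀ {c S} → ⟦ ⊥ ∈? Gs ⟧ + ⟦ ⊤ ∈? Gs ⟧ ≡ c → length Fs + c ≤ S → length Gs ≤ S
  conclude eq le = ≤-trans length≤ (≤-trans (≤-reflexive (cong (length Fs +_) eq)) le)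

  upper-bound : ∀ k → 2 ≤ k → k < n → G↑.YFree k → G↓.YFree k → length Gs ≤ Sigma n k
  upper-bound k 2≤k k<n yf yf′ with threshold n k (<⇒≤ 2≤k) (≤-trans (<⇒≤ k<n) (n≤1+n n))
  ... | t , thr = cases k 2≤k k<n yf yf′ thr (⊥ ∈? Gs) (⊤ ∈? Gs)
    where
    open ≤-Reasoning
    -- A shortfall of 1 saves `t ≥ 1` in the doubled inequality, which makes it strict and leaves
    -- room for one more set.
    one : ∀ k {m} → Threshold n k t → k < n → 2 * W ≤ m * n ! → m + 1 ≡ 2 * k → length Fs + 1 ≤ Sigma n k
    one k thr k<n le eq = ≤-trans (≤-reflexive (+-comm (length Fs) 1)) (*-cancelˡ-< 2 (length Fs) (Sigma n k) (<-≤-trans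
      (m<m+n (2 * length Fs) (≤-trans (threshold≥1 thr (≤-trans (<⇒≤ k<n) (n≤1+n n))) (≤-reflexive (sym (*-identityʳ t)))))
      (twoSided-size thr le eq)))

    cases : ∀ k → 2 ≤ k → k < n → G↑.YFree k → G↓.YFree k → Threshold n k t → Dec (⊥ ∈ Gs) → Dec (⊤ ∈ Gs) → length Gs ≤ Sigma n k
    cases k 2≤k k<n yf yf′ thr (no ⊥∉) (no ⊤∉) = conclude (cong₂ _+_ (⟦⟧-no (⊥ ∈? Gs) ⊥∉) (⟦⟧-no (⊤ ∈? Gs) ⊤∉))
      (*-cancelˡ-≤ 2 (≤-trans (≤-reflexive (solve 2 (λ l t → con 2 :* (l :+ con 0) := con 2 :* l :+ t :* con 0) refl (length Fs) t))
        (twoSided-size thr (LYM (free↑ yf) (free↓ yf′) 2≤k 2≤k) (solve 1 (λ k → k :+ k :+ con 0 := con 2 :* k) refl k))))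
      where open +-*-Solver using (solve; _:*_; _:+_; _:=_; con)
    cases 1 (s≤s ()) _ _ _ _ _ _
    cases 2 _ 2<n yf yf′ thr (yes ⊥∈) (no ⊤∉) = conclude (cong₂ _+_ (⟦⟧-yes (⊥ ∈? Gs) ⊥∈) (⟦⟧-no (⊤ ∈? Gs) ⊤∉))
      (≤-trans (≤-reflexive (+-comm (length Fs) 1)) (oneSided-strict (λ A → ¬? (↑.nonMax? A)) thr (≤-trans (s≤s z≤n) 2<n)
        (LYM↑ (free↑-pred ⊥∈ yf)) λ A∈ → let B , _ , B∈ , max = climb↑ A∈ in B , B∈ , max))
    cases 2 _ 2<n yf yf′ thr (no ⊥∉) (yes ⊤∈) = conclude (cong₂ _+_ (⟦⟧-no (⊥ ∈? Gs) ⊥∉) (⟦⟧-yes (⊤ ∈? Gs) ⊤∈))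
      (≤-trans (≤-reflexive (+-comm (length Fs) 1)) (oneSided-strict (λ A → ¬? (↓.nonMax? A)) thr (≤-trans (s≤s z≤n) 2<n)
        (LYM↓ (free↓-pred ⊤∈ yf′)) λ A∈ → let B , _ , B∈ , max = climb↓ A∈ in B , B∈ , max))
    cases 2 _ 2<n yf yf′ thr (yes ⊥∈) (yes ⊤∈) with all? (λ A → all? (comparable? A) Gs) Gs
    -- A chain has at most `n + 1` members, and `n` is the coefficient `n choose 1`, which is less
    -- than `2 * t`.
    ... | yes cmp = begin
        length Gs       ≤⟨ chain-size uniq-Gs (λ A∈ B∈ → All.lookup (All.lookup cmp A∈) B∈) ⟩
        suc n           ≡⟨ cong suc (sym (nC1≡n n)) ⟩
        suc (n choose 1) ≤⟨ C<2*threshold thr 2<n (≤-trans (s≤s z≤n) 2<n) ⟩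
        2 * t           ≤⟨ 2*threshold≤Sigma thr ⟩
        Sigma n 2       ∎
    -- The sets `⊥` and `⊤` are comparable with everything, so an incomparable pair in `Gs` lies in
    -- `Fs`.
    ... | no ¬cmp with find (¬All⇒Any¬ (λ A → all? (comparable? A) Gs) Gs ¬cmp)
    ...   | A , A∈ , ¬cmpA with find (¬All⇒Any¬ (comparable? A) Gs ¬cmpA)
    ...     | B , B∈ , ¬AB = conclude (cong₂ _+_ (⟦⟧-yes (⊥ ∈? Gs) ⊥∈) (⟦⟧-yes (⊤ ∈? Gs) ⊤∈))
              (incomparable-size thr 2<n (free↑-pred ⊥∈ yf) (free↓-pred ⊤∈ yf′)
                (incomparable⇒∈Fs A∈ ¬AB) (incomparable⇒∈Fs B∈ (¬AB ∘ ⊎-swap)) ¬AB)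
    -- Removing `⊥` allows `s = k - 1`, which is still at least 2, so the two-sided LYM inequality
    -- applies with a shortfall of 1.
    cases (suc (suc (suc j))) 2≤k k<n yf yf′ thr (yes ⊥∈) (no ⊤∉) =
      conclude (cong₂ _+_ (⟦⟧-yes (⊥ ∈? Gs) ⊥∈) (⟦⟧-no (⊤ ∈? Gs) ⊤∉))
        (one (3 + j) thr k<n (LYM (free↑-pred ⊥∈ yf) (free↓ yf′) (s≤s (s≤s z≤n)) 2≤k)
          (solve 1 (λ j → con 2 :+ j :+ (con 3 :+ j) :+ con 1 := con 2 :* (con 3 :+ j)) refl j))
      where open +-*-Solver using (solve; _:*_; _:+_; _:=_; con)
    cases (suc (suc (suc j))) 2≤k k<n yf yf′ thr (no ⊥∉) (yes ⊤∈) =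
      conclude (cong₂ _+_ (⟦⟧-no (⊥ ∈? Gs) ⊥∉) (⟦⟧-yes (⊤ ∈? Gs) ⊤∈))
        (one (3 + j) thr k<n (LYM (free↑ yf) (free↓-pred ⊤∈ yf′) 2≤k (s≤s (s≤s z≤n)))
          (solve 1 (λ j → con 3 :+ j :+ (con 2 :+ j) :+ con 1 := con 2 :* (con 3 :+ j)) refl j))
      where open +-*-Solver using (solve; _:*_; _:+_; _:=_; con)
    -- With `s = r = k - 1` the shortfall is 2 and saves `t` sets; `t ≥ 2` pays for both `⊥` and
    -- `⊤`.
    cases (suc (suc (suc j))) 2≤k k<n yf yf′ thr (yes ⊥∈) (yes ⊤∈) =
      conclude (cong₂ _+_ (⟦⟧-yes (⊥ ∈? Gs) ⊥∈) (⟦⟧-yes (⊤ ∈? Gs) ⊤∈))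
        (≤-trans (+-monoʳ-≤ (length Fs) (threshold≥2 thr k<n)) (*-cancelˡ-≤ 2 (≤-trans
          (≤-reflexive (solve 2 (λ l t → con 2 :* (l :+ t) := con 2 :* l :+ t :* con 2) refl (length Fs) t))
          (twoSided-size thr (LYM (free↑-pred ⊥∈ yf) (free↓-pred ⊤∈ yf′) (s≤s (s≤s z≤n)) (s≤s (s≤s z≤n)))
            (solve 1 (λ j → con 2 :+ j :+ (con 2 :+ j) :+ con 2 := con 2 :* (con 3 :+ j)) refl j)))))
      where open +-*-Solver using (solve; _:*_; _:+_; _:=_; con)

theorem1p2 : (k n : ℕ) → 2 ≤ k → k + 1 ≤ n →
    (Σ (Family n) λ F →
    ¬ ContainsInduced (Yk k) F × ¬ ContainsInduced (Yk' k) F ×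
    size F ≡ Sigma n k)
    × ((F : Family n) →
    ¬ ContainsInduced (Yk k) F → ¬ ContainsInduced (Yk' k) F →
    size F ≤ Sigma n k)
theorem1p2 k n 2≤k k+1≤n = lower-bound k n , λ F free free′ →
  UpperBound.upper-bound (sets F) (unique F) k 2≤k (subst (_≤ n) (+-comm k 1) k+1≤n)
    (Yk-free F free) (Yk'-free F free′)
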